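{- There is an absolute constant $\kappa>0$ such that for every $k\ge 3$ and every $m\ge 2$, $$c_{k,m}\ \ge\ \kappa\, A_{k-1,m},$$ i.e. $c_{k,m}=\Omega(A_{k-1,m})$ for every $k\geq 3$. Here $A_{1,m}=\binom{m}{\lceil m/2\rceil}$ and $A_{j,m}=\binom{A_{j-1,m}}{\lceil A_{j-1,m}/2\rceil}$ for $j\ge 2$, and $c_{k,m}$ is the best possible randomized competitive ratio of the parametrized metrical service system problem that can be achieved on all $k$-level hierarchically separated trees with $m$ request types.
   Context: Parametrized metrical service system (MSS): given are a finite metric space $(X,d)$ and a fixed collection of $m$ non-empty subsets $K_1,\dots,K_m$ of $X$ (the request types), known to the algorithm in advance. An instance consists of an initial state $s_0\in X$ and a finite sequence of requests $\boldsymbol\rho=(\rho_1,\rho_2,\dots)$, each $\rho_t\in\{K_1,\dots,K_m\}$, revealed one at a time. On arrival of $\rho_t$, the algorithm must choose a state $s_t\in\rho_t$ without knowledge of future requests. The cost of a solution is $\sum_{t\ge1}d(s_{t-1},s_t)$. Let $\mathrm{cost}^*(\boldsymbol\rho)$ be the minimum cost of a feasible (offline) solution. A randomized online algorithm $\mathcal A$ has competitive ratio $c$ if there is a constant $\beta$, independent of the input sequence (but possibly depending on the metric space), such that $\mathbb E[\mathrm{cost}_{\mathcal A}(\boldsymbol\rho)]\le c\cdot \mathrm{cost}^*(\boldsymbol\rho)+\beta$ for every (fixed) input. Hierarchically separated tree (HST): a finite rooted edge-weighted tree in which all root-to-leaf paths have the same number of edges; the level of a node is the number of edges from it to any descendant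 leaf (leaves have level $0$); the edges between an internal node and all of its children have the same weight, which depends only on the level of the node. The points of the metric space are the leaves, with the tree path distance. It is a $k$-level HST if its root has level $k$. $c_{k,m}$ denotes the infimum of all $c$ such that for every $k$-level HST and every collection of $m$ request types on it there is a randomized online algorithm with competitive ratio $c$. -}

module Defs where

open import Level using (Level; _⊔_) renaming (suc to lsuc)
open import Algebra.Bundles using (CommutativeRing)
import Algebra.Definitions.RawMonoid as Multiples
open import Algebra.Structures using (IsCommutativeRing)
open import Data.Bool.Base using (Bool; T)
open import Data.Bool.Properties using (T?)
open import Data.Empty using (⊥-elim)
open import Data.Fin.Base using (Fin; zero; suc)
open import Data.Fin.Properties using (_≟_)
open import Data.List.Base using (List; []; _∷_; map; foldr; concat; filter; allFin)
open import Data.List.Membership.Propositional using (_∈_)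
open import Data.List.Membership.Propositional.Properties
  using (∈-map⁺; ∈-map⁻; ∈-concat⁺′; ∈-allFin; ∈-filter⁺)
open import Data.List.Relation.Binary.Pointwise using (Pointwise; []; _∷_)
import Data.List.Relation.Unary.All as ListAll
import Data.List.Relation.Unary.All.Properties as ListAllₚ
open import Data.List.Relation.Unary.Any using (here)
import Data.List.Relation.Unary.AllPairs as AllPairs
import Data.List.Relation.Unary.AllPairs.Properties as AllPairsₚ
open import Data.List.Relation.Unary.Unique.Propositional using (Unique)
import Data.List.Relation.Unary.Unique.Propositional.Properties as Uniqueₚ
open import Data.Nat.Base as ℕ using (ℕ; zero; suc; ⌈_/2⌉)
open import Data.Nat.Combinatorics using (_C_)
open import Data.Product.Base using (Σ; ∃; _×_; _,_; proj₁; proj₂)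
open import Data.Sum.Base using (inj₁; inj₂)
open import Data.Unit.Base using (⊤; tt)
open import Data.Vec.Base as Vec using (Vec; []; _∷_)
open import Data.Vec.Relation.Unary.All as VecAll using (All; []; _∷_)
open import Function.Base using (_∘_)
open import Relation.Binary.Bundles using (TotalOrder)
open import Relation.Binary.Core using (Rel)
open import Relation.Binary.PropositionalEquality.Core as ≡ using (_≡_; _≢_)
open import Relation.Binary.Structures using (IsDecTotalOrder)
open import Relation.Nullary using (¬_; yes; no)

------------------------------------------------------------------------
-- Real numbers

-- There is no type of real numbers to refer to, so everything below is
-- parametrised by an arbitrary Archimedean ordered field.  Classically these
-- are exactly the subfields of ℝ; ℝ itself is one of them.  The Archimedean
-- property matters: over a non-Archimedean field an additive constant could
-- exceed the cost of every finite request sequence.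

record ArchimedeanOrderedField (a ℓ₁ ℓ₂ : Level) : Set (lsuc (a ⊔ ℓ₁ ⊔ ℓ₂)) where
  infix  4 _≈_ _≤_ _<_
  infixl 6 _+_
  infixl 7 _*_
  infix  8 -_
  field
    Carrier           : Set a
    _≈_               : Rel Carrier ℓ₁
    _≤_               : Rel Carrier ℓ₂
    _+_ _*_           : Carrier → Carrier → Carrier
    -_                : Carrier → Carrier
    0# 1#             : Carrier
    isCommutativeRing : IsCommutativeRing _≈_ _+_ _*_ -_ 0# 1#
    isDecTotalOrder   : IsDecTotalOrder _≈_ _≤_
    0≉1               : ¬ 0# ≈ 1#
    invertible        : ∀ x → ¬ x ≈ 0# → ∃ λ y → x * y ≈ 1#
    +-monoʳ-≤         : ∀ x {y z} → y ≤ z → x + y ≤ x + z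
    *-nonNeg          : ∀ {x y} → 0# ≤ x → 0# ≤ y → 0# ≤ x * y

  commutativeRing : CommutativeRing a ℓ₁
  commutativeRing = record { isCommutativeRing = isCommutativeRing }

  open CommutativeRing commutativeRing public
    using ( refl; sym; trans; setoid; semiring
          ; +-cong; +-comm; +-assoc; +-identityˡ; +-identityʳ )

  open IsDecTotalOrder isDecTotalOrder public
    using (isTotalOrder; _≤?_)
    renaming ( refl to ≤-refl; reflexive to ≤-reflexive; trans to ≤-trans
             ; antisym to ≤-antisym; total to ≤-total )

  totalOrder : TotalOrder a ℓ₁ ℓ₂
  totalOrder = record { isTotalOrder = isTotalOrder }

  _<_ : Rel Carrier (ℓ₁ ⊔ ℓ₂)
  x < y = x ≤ y × ¬ x ≈ y

  fromℕ : ℕ → Carrier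
  fromℕ n = Multiples._×_ (CommutativeRing.+-rawMonoid commutativeRing) n 1#

  field
    archimedean : ∀ x → ∃ λ n → x ≤ fromℕ n

module MSS {a ℓ₁ ℓ₂ : Level} (F : ArchimedeanOrderedField a ℓ₁ ℓ₂) where

  open ArchimedeanOrderedField F

  -- x ≤inf P says x ≤ inf P, the infimum being taken in the extended reals:
  -- x is at most inf P exactly when x is a lower bound of P (and inf ∅ = +∞).

  infix 4 _≤inf_

  _≤inf_ : ∀ {p} → Carrier → (Carrier → Set p) → Set (a ⊔ ℓ₂ ⊔ p)
  x ≤inf P = ∀ c → P c → x ≤ c

  private
    +-mono-≤ : ∀ {x y u v} → x ≤ y → u ≤ v → x + u ≤ y + v
    +-mono-≤ {x} {y} {u} {v} x≤y u≤v = ≤-trans (+-monoʳ-≤ x u≤v)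
      (≤-trans (≤-reflexive (+-comm x v))
        (≤-trans (+-monoʳ-≤ v x≤y) (≤-reflexive (+-comm v y))))

    +-nonNeg : ∀ {x y} → 0# ≤ x → 0# ≤ y → 0# ≤ x + y
    +-nonNeg 0≤x 0≤y = ≤-trans (≤-reflexive (sym (+-identityˡ 0#))) (+-mono-≤ 0≤x 0≤y)

    ≤+ˡ : ∀ {x y} → 0# ≤ x → y ≤ x + y
    ≤+ˡ {y = y} 0≤x = ≤-trans (≤-reflexive (sym (+-identityˡ y))) (+-mono-≤ 0≤x ≤-refl)

    ≤+ʳ : ∀ {x y} → 0# ≤ y → x ≤ x + y
    ≤+ʳ {x} 0≤y = ≤-trans (≤-reflexive (sym (+-identityʳ x))) (+-mono-≤ ≤-refl 0≤y)

    +-pos : ∀ {x y} → 0# < x → 0# ≤ y → 0# < x + y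
    +-pos (0≤x , 0≉x) 0≤y = +-nonNeg 0≤x 0≤y ,
      λ 0≈x+y → 0≉x (≤-antisym 0≤x (≤-trans (≤+ʳ 0≤y) (≤-reflexive (sym 0≈x+y))))

  ----------------------------------------------------------------------
  -- Finite metric spaces

  record FiniteMetricSpace : Set (lsuc Level.zero ⊔ a ⊔ ℓ₁ ⊔ ℓ₂) where
    field
      Point    : Set
      points   : List Point
      complete : ∀ x → x ∈ points
      unique   : Unique points
      d        : Point → Point → Carrier
      d-refl   : ∀ x → d x x ≈ 0#
      d-pos    : ∀ {x y} → x ≢ y → 0# < d x y
      d-sym    : ∀ x y → d x y ≈ d y x
      d-tri    : ∀ x y z → d x z ≤ d x y + d y z

    ∑ : (Point → Carrier) → Carrier
    ∑ f = foldr _+_ 0# (map f points)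

  ----------------------------------------------------------------------
  -- Metrical service systems

  module _ (X : FiniteMetricSpace) where

    open FiniteMetricSpace X

    record RequestTypes (m : ℕ) : Set where
      field
        K        : Fin m → Point → Bool
        nonEmpty : ∀ i → ∃ λ x → T (K i x)

  module Service (X : FiniteMetricSpace) {m : ℕ} (𝒦 : RequestTypes X m) where

    open FiniteMetricSpace X
    open RequestTypes 𝒦

    cost : Point → List Point → Carrier
    cost s []       = 0#
    cost s (x ∷ xs) = d s x + cost x xs

    Feasible : List (Fin m) → List Point → Set
    Feasible = Pointwise (λ i x → T (K i x))

    Optimal : Point → List (Fin m) → List Point → Set ℓ₂
    Optimal s ρ xs =
      Feasible ρ xs × (∀ ys → Feasible ρ ys → cost s xs ≤ cost s ys)

    optimum : ∀ s ρ → ∃ (Optimal s ρ)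
    optimum s []      = [] , [] , λ { [] [] → ≤-refl }
    optimum s (i ∷ ρ) =
      (x* ∷ next x*) , (x*∈K ∷ proj₁ (proj₂ (optimum x* ρ))) , x*-least
      where
      open import Data.List.Extrema totalOrder
        using (argmin; argmin-all; f[argmin]≤f[xs])

      next : Point → List Point
      next x = proj₁ (optimum x ρ)

      via : Point → Carrier
      via x = d s x + cost x (next x)

      candidates : List Point
      candidates = filter (T? ∘ K i) points

      x* : Point
      x* = argmin via (proj₁ (nonEmpty i)) candidates

      x*∈K : T (K i x*)
      x*∈K = argmin-all via (proj₂ (nonEmpty i)) (ListAllₚ.all-filter (T? ∘ K i) points)

      x*-least : ∀ ys → Feasible (i ∷ ρ) ys → via x* ≤ cost s ys
      x*-least (y ∷ ys) (y∈K ∷ feasible) = ≤-trans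
        (ListAll.lookup (f[argmin]≤f[xs] {f = via} _ candidates)
          (∈-filter⁺ (T? ∘ K i) (complete y) y∈K))
        (+-monoʳ-≤ (d s y) (proj₂ (proj₂ (optimum y ρ)) ys feasible))

    cost* : Point → List (Fin m) → Carrier
    cost* s ρ = cost s (proj₁ (optimum s ρ))

    -- Requests served so far with the states chosen for them, latest first.

    History : Set
    History = List (Fin m × Point)

    current : Point → History → Point
    current s₀ []            = s₀
    current s₀ ((_ , x) ∷ _) = x

    -- A randomized algorithm is given in behavioural form: prob s₀ h i x is the
    -- probability of moving to x on request i, conditional on the initial state
    -- and on everything that happened so far.  As the algorithm remembers its
    -- whole past, this is as general as randomizing over deterministic
    -- algorithms.

    record RandomizedAlgorithm : Set (a ⊔ ℓ₁ ⊔ ℓ₂) where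
      field
        prob     : Point → History → Fin m → Point → Carrier
        nonNeg   : ∀ s₀ h i x → 0# ≤ prob s₀ h i x
        total    : ∀ s₀ h i → ∑ (prob s₀ h i) ≈ 1#
        feasible : ∀ s₀ h i x → ¬ T (K i x) → prob s₀ h i x ≈ 0#

    module _ (𝒜 : RandomizedAlgorithm) where

      open RandomizedAlgorithm 𝒜

      expectedCostFrom : Point → History → List (Fin m) → Carrier
      expectedCostFrom s₀ h []      = 0#
      expectedCostFrom s₀ h (i ∷ ρ) = ∑ λ x →
        prob s₀ h i x * (d (current s₀ h) x + expectedCostFrom s₀ ((i , x) ∷ h) ρ)

      expectedCost : Point → List (Fin m) → Carrier
      expectedCost s₀ ρ = expectedCostFrom s₀ [] ρ

      Competitive : Carrier → Set (a ⊔ ℓ₂)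
      Competitive c = ∃ λ β → ∀ s₀ ρ → expectedCost s₀ ρ ≤ c * cost* s₀ ρ + β

  ----------------------------------------------------------------------
  -- Hierarchically separated trees

  -- Rooted trees of level k whose root-to-leaf paths all have k edges; a node
  -- that is not a leaf has at least one child.

  data Tree : ℕ → Set where
    leaf : Tree 0
    node : ∀ {k} (n : ℕ) → (Fin (suc n) → Tree k) → Tree (suc k)

  Leaf : ∀ {k} → Tree k → Set
  Leaf leaf        = ⊤
  Leaf (node n ts) = Σ (Fin (suc n)) λ i → Leaf (ts i)

  leaves : ∀ {k} (t : Tree k) → List (Leaf t)
  leaves leaf        = tt ∷ []
  leaves (node n ts) = concat (map (λ i → map (i ,_) (leaves (ts i))) (allFin (suc n)))

  -- weights lists the edge weights from the root downwards: its head is the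
  -- weight of the edges between the root and its children.

  record HST (k : ℕ) : Set (a ⊔ ℓ₁ ⊔ ℓ₂) where
    field
      tree     : Tree k
      weights  : Vec Carrier k
      positive : All (0# <_) weights

  depth : ∀ {k} → Vec Carrier k → Carrier
  depth = Vec.foldr′ _+_ 0#

  -- The path between leaves below different children of a node goes up to that
  -- node and down again, and all leaves below it are at the same distance.

  dist : ∀ {k} → Vec Carrier k → (t : Tree k) → Leaf t → Leaf t → Carrier
  dist []       leaf        _       _       = 0#
  dist (w ∷ ws) (node n ts) (i , x) (j , y) with i ≟ j
  ... | yes ≡.refl = dist ws (ts i) x y
  ... | no  _      = depth (w ∷ ws) + depth (w ∷ ws)

  leaves-complete : ∀ {k} (t : Tree k) (x : Leaf t) → x ∈ leaves t
  leaves-complete leaf        tt      = here ≡.refl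
  leaves-complete (node n ts) (i , x) = ∈-concat⁺′
    (∈-map⁺ (i ,_) (leaves-complete (ts i) x))
    (∈-map⁺ (λ j → map (j ,_) (leaves (ts j))) (∈-allFin i))

  leaves-unique : ∀ {k} (t : Tree k) → Unique (leaves t)
  leaves-unique leaf        = ListAll.[] AllPairs.∷ AllPairs.[]
  leaves-unique (node n ts) = Uniqueₚ.concat⁺
    (ListAllₚ.map⁺ (ListAll.universal
      (λ i → Uniqueₚ.map⁺ (λ { ≡.refl → ≡.refl }) (leaves-unique (ts i))) (allFin (suc n))))
    (AllPairsₚ.map⁺ (AllPairs.map apart (Uniqueₚ.allFin⁺ (suc n))))
    where
    open import Data.List.Relation.Binary.Disjoint.Propositional using (Disjoint)
    apart : ∀ {i j} → i ≢ j →
            Disjoint (map (i ,_) (leaves (ts i))) (map (j ,_) (leaves (ts j)))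
    apart i≢j (v∈i , v∈j) with ∈-map⁻ _ v∈i | ∈-map⁻ _ v∈j
    ... | _ , _ , ≡.refl | _ , _ , ≡.refl = i≢j ≡.refl

  depth-nonNeg : ∀ {k} {ws : Vec Carrier k} → All (0# <_) ws → 0# ≤ depth ws
  depth-nonNeg []         = ≤-refl
  depth-nonNeg (0<w ∷ ps) = +-nonNeg (proj₁ 0<w) (depth-nonNeg ps)

  dist-refl : ∀ {k} (ws : Vec Carrier k) t x → dist ws t x x ≈ 0#
  dist-refl []       leaf        tt      = refl
  dist-refl (w ∷ ws) (node n ts) (i , x) with i ≟ i
  ... | yes ≡.refl = dist-refl ws (ts i) x
  ... | no  i≢i    = ⊥-elim (i≢i ≡.refl)

  dist-sym : ∀ {k} (ws : Vec Carrier k) t x y → dist ws t x y ≈ dist ws t y x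
  dist-sym []       leaf        tt      tt      = refl
  dist-sym (w ∷ ws) (node n ts) (i , x) (j , y) with i ≟ j | j ≟ i
  ... | yes ≡.refl | yes ≡.refl = dist-sym ws (ts i) x y
  ... | yes ≡.refl | no  i≢i    = ⊥-elim (i≢i ≡.refl)
  ... | no  i≢i    | yes ≡.refl = ⊥-elim (i≢i ≡.refl)
  ... | no  _      | no  _      = refl

  dist-pos : ∀ {k} {ws : Vec Carrier k} → All (0# <_) ws →
             ∀ t {x y} → x ≢ y → 0# < dist ws t x y
  dist-pos []         leaf        {tt}    {tt}    x≢y = ⊥-elim (x≢y ≡.refl)
  dist-pos (0<w ∷ ps) (node n ts) {i , x} {j , y} x≢y with i ≟ j
  ... | yes ≡.refl = dist-pos ps (ts i) (x≢y ∘ ≡.cong (i ,_))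
  ... | no  _      = +-pos (+-pos 0<w (depth-nonNeg ps)) (depth-nonNeg (0<w ∷ ps))

  dist-nonNeg : ∀ {k} {ws : Vec Carrier k} → All (0# <_) ws →
                ∀ t x y → 0# ≤ dist ws t x y
  dist-nonNeg []         leaf        tt      tt      = ≤-refl
  dist-nonNeg (0<w ∷ ps) (node n ts) (i , x) (j , y) with i ≟ j
  ... | yes ≡.refl = dist-nonNeg ps (ts i) x y
  ... | no  _      = +-nonNeg (depth-nonNeg (0<w ∷ ps)) (depth-nonNeg (0<w ∷ ps))

  dist≤2depth : ∀ {k} {ws : Vec Carrier k} → All (0# <_) ws →
                ∀ t x y → dist ws t x y ≤ depth ws + depth ws
  dist≤2depth []         leaf        tt      tt      = +-nonNeg ≤-refl ≤-refl
  dist≤2depth (0<w ∷ ps) (node n ts) (i , x) (j , y) with i ≟ j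
  ... | yes ≡.refl = ≤-trans (dist≤2depth ps (ts i) x y)
                       (+-mono-≤ (≤+ˡ (proj₁ 0<w)) (≤+ˡ (proj₁ 0<w)))
  ... | no  _      = ≤-refl

  dist-tri : ∀ {k} {ws : Vec Carrier k} → All (0# <_) ws →
             ∀ t x y z → dist ws t x z ≤ dist ws t x y + dist ws t y z
  dist-tri []         leaf        tt      tt      tt      = +-nonNeg ≤-refl ≤-refl
  dist-tri {ws = w ∷ ws} ps′@(0<w ∷ ps) (node n ts) (i , x) (j , y) (l , z)
    with i ≟ j | j ≟ l | i ≟ l
  ... | yes ≡.refl | yes ≡.refl | yes ≡.refl = dist-tri ps (ts i) x y z
  ... | yes ≡.refl | yes ≡.refl | no  i≢i    = ⊥-elim (i≢i ≡.refl)
  ... | yes ≡.refl | no  i≢i    | yes ≡.refl = ⊥-elim (i≢i ≡.refl)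
  ... | no  i≢i    | yes ≡.refl | yes ≡.refl = ⊥-elim (i≢i ≡.refl)
  ... | yes ≡.refl | no  _      | no  _      = ≤+ˡ (dist-nonNeg ps (ts i) x y)
  ... | no  _      | yes ≡.refl | no  _      = ≤+ʳ (dist-nonNeg ps (ts j) y z)
  ... | no  _      | no  _      | no  _      =
    ≤+ˡ (+-nonNeg (depth-nonNeg ps′) (depth-nonNeg ps′))
  ... | no  _      | no  _      | yes ≡.refl = ≤-trans
    (≤-trans (dist≤2depth ps (ts i) x z)
      (+-mono-≤ (≤+ˡ (proj₁ 0<w)) (≤+ˡ (proj₁ 0<w))))
    (≤+ˡ (+-nonNeg (depth-nonNeg ps′) (depth-nonNeg ps′)))

  leafSpace : ∀ {k} → HST k → FiniteMetricSpace
  leafSpace H = record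
    { Point    = Leaf tree
    ; points   = leaves tree
    ; complete = leaves-complete tree
    ; unique   = leaves-unique tree
    ; d        = dist weights tree
    ; d-refl   = dist-refl weights tree
    ; d-pos    = dist-pos positive tree
    ; d-sym    = dist-sym weights tree
    ; d-tri    = dist-tri positive tree
    }
    where open HST H

  -- The ratios of which c_{k,m} is the infimum.

  Achievable : ℕ → ℕ → Carrier → Set (a ⊔ ℓ₁ ⊔ ℓ₂)
  Achievable k m c =
    (H : HST k) (𝒦 : RequestTypes (leafSpace H) m) →
    let open Service (leafSpace H) 𝒦 in
    ∃ λ (𝒜 : RandomizedAlgorithm) → Competitive 𝒜 c

-- Starting the recursion at A 0 m = m gives A 1 m = m C ⌈ m /2⌉.

A : ℕ → ℕ → ℕ
A zero    m = m
A (suc j) m = A j m C ⌈ A j m /2⌉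

{-# OPTIONS --safe #-}

-- Requests of a higher level can be simulated by long sequences of lower ones.
-- Let a level-j subtree be able to reject any prescribed set of N "kinds" of
-- level-j requests.  For a set σ of ⌈N/2⌉ kinds, repeat all kinds in σ many
-- times over: a child that accepts exactly σ serves this at negligible cost,
-- while a child accepting a different set of the same size rejects some kind in
-- σ, so that every repetition costs the algorithm as much as changing the child.
-- With edge weights growing fast enough, staying in a subtree none of whose
-- children accepts σ is then as expensive as leaving the subtree.  So level j + 1
-- has N C ⌈N/2⌉ kinds, and level j has A j m of them.
--
-- Put N = A (k - 1) m and h = ⌈N/2⌉, and give the root one child for every
-- choice of h kinds.  Every child rejects at least N - h kinds, so by averaging
-- the adversary finds a kind that costs the algorithm a constant fraction of the
-- diameter in expectation.  After h such requests there is still a child that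
-- accepts them all, and the optimum has paid for only one move to it.

module Submission where

open import Level using (Level)
open import Algebra.Bundles using (CommutativeRing)
import Algebra.Properties.Group as GroupProperties
import Algebra.Properties.Ring as RingProperties
import Algebra.Properties.Semiring.Mult as SemiringMult
import Algebra.Solver.Ring.NaturalCoefficients.Default as NatSolver
open import Data.Bool.Base using (Bool; true; false; T; _∧_; if_then_else_)
open import Data.Bool.Properties using (T?; T-∧)
open import Data.Empty using (⊥-elim)
open import Data.Fin.Base using (Fin; zero; suc; finToFun; funToFin; fromℕ<)
open import Data.Fin.Properties using (_≟_; any?; finToFun-funToFin)
open import Data.Fin.Subset using (Subset; inside; outside; ∣_∣; ⊥)
open import Data.Fin.Subset.Properties using (∣⊥∣≡0)
open import Data.List.Base as List
  using (List; []; _∷_; _++_; map; concat; concatMap; filter; foldr; length; replicate; allFin)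
open import Data.List.Membership.Propositional using (_∈_)
open import Data.List.Membership.Propositional.Properties
  using (∈-map⁺; ∈-map⁻; ∈-++⁺ˡ; ∈-++⁺ʳ; ∈-++⁻; ∈-lookup; ∈-filter⁺; ∈-allFin)
open import Data.List.Properties
  using (length-++; length-map; length-filter; length-tabulate; ++-assoc; ++-identityʳ)
open import Data.List.Relation.Binary.Pointwise as Pointwise using (Pointwise; []; _∷_)
open import Data.List.Relation.Unary.All as ListAll using ([]; _∷_)
import Data.List.Relation.Unary.All.Properties as ListAllₚ
import Data.List.Relation.Unary.AllPairs as AllPairs
open import Data.List.Relation.Unary.Any as Any using (here; there)
open import Data.List.Relation.Unary.Any.Properties using (lookup-index)
open import Data.List.Relation.Unary.Unique.Propositional using (Unique)
import Data.List.Relation.Unary.Unique.Propositional.Properties as Uniqueₚ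
open import Data.Nat.Base as ℕ using (ℕ; zero; suc; pred; _∸_; z≤n; s≤s; ⌈_/2⌉; ⌊_/2⌋)
open import Data.Nat.ListAction using (sum)
import Data.Nat.Properties as ℕₚ
open import Data.Nat.Tactic.RingSolver using (solve-∀)
open import Data.Product.Base using (∃; ∃₂; _×_; _,_; proj₁; proj₂)
open import Data.Sum.Base using (_⊎_; inj₁; inj₂)
open import Data.Unit.Base using (tt)
open import Data.Vec.Base as Vec using (Vec; []; _∷_; lookup; toList)
open import Data.Vec.Properties using (length-toList; ∷-injectiveʳ)
open import Data.Vec.Relation.Unary.All as VecAll using (All; []; _∷_)
import Data.Vec.Relation.Unary.All.Properties as VecAllₚ
open import Function.Base using (_∘_; id)
open import Function.Bundles using (Equivalence)
open import Relation.Binary.Bundles using (TotalOrder)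
open import Relation.Binary.PropositionalEquality as ≡ using (_≡_; _≢_)
import Relation.Binary.Reasoning.PartialOrder as PosetReasoning
open import Relation.Nullary using (¬_; yes; no)
open import Relation.Nullary.Decidable using (isYes; fromWitness)
open import Defs

-- Antichains formed by the subsets of a given size.

module Discrete where

  open import Data.Nat.Combinatorics using (_C_; nCk+nC[k+1]≡[n+1]C[k+1])
  open import Data.Nat.Base using (_+_; _*_; _≤_; _<_)
  open ℕₚ hiding (_≟_)
  open ≡ using (refl; sym; trans; cong; cong₂; subst)

  -- What the construction asks of the sets that label the children: `nonempty` and `separates` make
  -- a wrong child reject something, and `covers` keeps every request type servable.
  record Antichain (c n : ℕ) : Set where
    field
      member    : Fin c → Fin n → Bool
      nonempty  : ∀ a → ∃ λ x → T (member a x)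
      separates : ∀ {a b} → a ≢ b → ∃ λ x → T (member a x) × ¬ T (member b x)
      covers    : ∀ x → ∃ λ a → T (member a x)

  combinations : ∀ n → ℕ → List (Subset n)
  combinations n       zero    = ⊥ ∷ []
  combinations zero    (suc k) = []
  combinations (suc n) (suc k) =
    map (inside ∷_) (combinations n k) ++ map (outside ∷_) (combinations n (suc k))

  length-combinations : ∀ n k → length (combinations n k) ≡ n C k
  length-combinations n       zero    = refl
  length-combinations zero    (suc k) = refl
  length-combinations (suc n) (suc k) = trans
    (length-++ (map (inside ∷_) (combinations n k)))
    (trans (cong₂ _+_
        (trans (length-map _ (combinations n k)) (length-combinations n k))
        (trans (length-map _ (combinations n (suc k))) (length-combinations n (suc k))))
      (nCk+nC[k+1]≡[n+1]C[k+1] n k))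

  combinations-unique : ∀ n k → Unique (combinations n k)
  combinations-unique n       zero    = [] AllPairs.∷ AllPairs.[]
  combinations-unique zero    (suc k) = AllPairs.[]
  combinations-unique (suc n) (suc k) = Uniqueₚ.++⁺
    (Uniqueₚ.map⁺ ∷-injectiveʳ (combinations-unique n k))
    (Uniqueₚ.map⁺ ∷-injectiveʳ (combinations-unique n (suc k)))
    λ (p∈ , p∈′) → disjoint (∈-map⁻ _ p∈) (∈-map⁻ _ p∈′)
    where
    disjoint : ∀ {p : Subset (suc n)} {P Q : Subset n → Set} →
               (∃ λ q → P q × p ≡ inside ∷ q) → ¬ (∃ λ q → Q q × p ≡ outside ∷ q)
    disjoint (_ , _ , refl) (_ , _ , ())

  combinations-size : ∀ n k {p} → p ∈ combinations n k → ∣ p ∣ ≡ k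
  combinations-size n       zero    (here refl) = ∣⊥∣≡0 n
  combinations-size (suc n) (suc k) p∈
    with ∈-++⁻ (map (inside ∷_) (combinations n k)) p∈
  ... | inj₁ p∈ˡ with _ , q∈ , refl ← ∈-map⁻ _ p∈ˡ = cong suc (combinations-size n k q∈)
  ... | inj₂ p∈ʳ with _ , q∈ , refl ← ∈-map⁻ _ p∈ʳ = combinations-size n (suc k) q∈

  ∣p∣≡0⇒p≡⊥ : ∀ {n} (p : Subset n) → ∣ p ∣ ≡ 0 → p ≡ ⊥
  ∣p∣≡0⇒p≡⊥ []            _  = refl
  ∣p∣≡0⇒p≡⊥ (outside ∷ p) eq = cong (outside ∷_) (∣p∣≡0⇒p≡⊥ p eq)

  combinations-complete : ∀ {n} k (p : Subset n) → ∣ p ∣ ≡ k → p ∈ combinations n k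
  combinations-complete         zero    p             eq = here (∣p∣≡0⇒p≡⊥ p eq)
  combinations-complete {suc n} (suc k) (inside ∷ p)  eq =
    ∈-++⁺ˡ (∈-map⁺ _ (combinations-complete k p (suc-injective eq)))
  combinations-complete {suc n} (suc k) (outside ∷ p) eq =
    ∈-++⁺ʳ (map (inside ∷_) (combinations n k)) (∈-map⁺ _ (combinations-complete (suc k) p eq))

  subset-through : ∀ {n} k → suc k ≤ n → (x : Fin n) →
                   ∃ λ (p : Subset n) → ∣ p ∣ ≡ suc k × T (lookup p x)
  subset-through {suc n}       zero    _         zero    = inside ∷ ⊥ , cong suc (∣⊥∣≡0 n) , tt
  subset-through {suc (suc n)} zero    _         (suc x) =
    let p , size , x∈p = subset-through zero (s≤s z≤n) x in outside ∷ p , size , x∈p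
  subset-through {suc (suc n)} (suc k) (s≤s k≤n) zero    =
    let p , size , _ = subset-through k k≤n zero in inside ∷ p , cong suc size , tt
  subset-through {suc (suc n)} (suc k) (s≤s k≤n) (suc x) =
    let p , size , x∈p = subset-through k k≤n x in inside ∷ p , cong suc size , x∈p

  -- Equal sizes become unequal once a member of `q` outside `p` is passed, so the hypothesis is an
  -- inequality, which survives the recursion.
  separating-element : ∀ {n} {p q : Subset n} → ∣ q ∣ ≤ ∣ p ∣ → p ≢ q →
                       ∃ λ x → T (lookup p x) × ¬ T (lookup q x)
  separating-element {p = []}          {[]}          _   p≢q = ⊥-elim (p≢q refl)
  separating-element {p = inside ∷ p}  {outside ∷ q} _   _   = zero , tt , id
  separating-element {p = inside ∷ p}  {inside ∷ q}  q≤p p≢q =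
    let x , sep = separating-element (ℕ.s≤s⁻¹ q≤p) (p≢q ∘ cong (inside ∷_)) in suc x , sep
  separating-element {p = outside ∷ p} {outside ∷ q} q≤p p≢q =
    let x , sep = separating-element q≤p (p≢q ∘ cong (outside ∷_)) in suc x , sep
  separating-element {p = outside ∷ p} {inside ∷ q}  q<p _   =
    let x , sep = separating-element {p = p} {q} (<⇒≤ q<p)
          (λ p≡q → <-irrefl (cong ∣_∣ (sym p≡q)) q<p)
    in suc x , sep

  nonempty-subset : ∀ {n} (p : Subset n) → 1 ≤ ∣ p ∣ → ∃ λ x → T (lookup p x)
  nonempty-subset (inside ∷ p)  _   = zero , tt
  nonempty-subset (outside ∷ p) 1≤p = let x , x∈p = nonempty-subset p 1≤p in suc x , x∈p

  lookup-injective : ∀ {A : Set} {xs : List A} → Unique xs → ∀ {i j} →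
                  List.lookup xs i ≡ List.lookup xs j → i ≡ j
  lookup-injective {xs = _ ∷ _} (_ AllPairs.∷ _)  {zero}  {zero}  _  = refl
  lookup-injective {xs = _ ∷ _} (x∉ AllPairs.∷ _) {zero}  {suc j} eq =
    ⊥-elim (ListAll.lookup x∉ (∈-lookup j) eq)
  lookup-injective {xs = _ ∷ _} (x∉ AllPairs.∷ _) {suc i} {zero}  eq =
    ⊥-elim (ListAll.lookup x∉ (∈-lookup i) (sym eq))
  lookup-injective {xs = _ ∷ _} (_ AllPairs.∷ u)  {suc i} {suc j} eq = cong suc (lookup-injective u eq)

  subsetAntichain : ∀ n k → 1 ≤ k → k ≤ n → Antichain (n C k) n
  subsetAntichain n (suc k) _ k≤n =
    subst (λ c → Antichain c n) (length-combinations n (suc k)) record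
      { member    = λ a → lookup (subset a)
      ; nonempty  = λ a → nonempty-subset (subset a) (subst (1 ≤_) (sym (size a)) (s≤s z≤n))
      ; separates = λ {a} {b} a≢b → separating-element
          (≤-reflexive (trans (size b) (sym (size a))))
          (a≢b ∘ lookup-injective (combinations-unique n (suc k)))
      ; covers    = λ x →
          let p , ∣p∣ , x∈p = subset-through k k≤n x
              p∈ = combinations-complete (suc k) p ∣p∣
          in Any.index p∈ , subst (λ q → T (lookup q x)) (lookup-index p∈) x∈p
      }
    where
    subset : Fin (length (combinations n (suc k))) → Subset n
    subset = List.lookup (combinations n (suc k))

    size : ∀ a → ∣ subset a ∣ ≡ suc k
    size a = combinations-size n (suc k) (∈-lookup a)

  0<nCk : ∀ {n k} → k ≤ n → 0 < n C k
  0<nCk {k = zero}        _         = s≤s z≤n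
  0<nCk {suc n} {suc k}   (s≤s k≤n) =
    subst (0 <_) (nCk+nC[k+1]≡[n+1]C[k+1] n k) (≤-trans (0<nCk k≤n) (m≤m+n _ _))

  1<nCk : ∀ {n k} → 0 < k → k < n → 1 < n C k
  1<nCk {suc n} {suc k} _ (s≤s k<n) =
    subst (1 <_) (nCk+nC[k+1]≡[n+1]C[k+1] n k) (+-mono-≤ (0<nCk (<⇒≤ k<n)) (0<nCk k<n))

  0<⌈n/2⌉ : ∀ {n} → 2 ≤ n → 0 < ⌈ n /2⌉
  0<⌈n/2⌉ (s≤s (s≤s _)) = s≤s z≤n

  2≤A : ∀ {m} j → 2 ≤ m → 2 ≤ A j m
  2≤A zero    2≤m = 2≤m
  2≤A (suc j) 2≤m = 1<nCk (0<⌈n/2⌉ (2≤A j 2≤m)) (⌈n/2⌉<n′ (2≤A j 2≤m))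
    where
    ⌈n/2⌉<n′ : ∀ {n} → 2 ≤ n → ⌈ n /2⌉ < n
    ⌈n/2⌉<n′ (s≤s (s≤s _)) = ⌈n/2⌉<n _

  -- By Sperner's theorem the middle layer is an antichain of the largest possible size, hence the
  -- binomial coefficient in the recursion for `A`.
  halfSubsets : ∀ n → 2 ≤ n → Antichain (n C ⌈ n /2⌉) n
  halfSubsets n 2≤n = subsetAntichain n ⌈ n /2⌉ (0<⌈n/2⌉ 2≤n) (⌈n/2⌉≤n n)

  -- Tuples instead of sets of `h` elements, because the adversary may ask for a kind twice within a
  -- phase. Agreement is pointwise, which avoids function extensionality.
  EnumeratesFunctions : ∀ h n {c} → (Fin c → Fin h → Fin n) → Set
  EnumeratesFunctions h n φ = (f : Fin h → Fin n) → ∃ λ c → ∀ i → φ c i ≡ f i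

  enumerate-functions : ∀ h n → ∃ λ p → ∃ (EnumeratesFunctions h (suc n) {suc p})
  enumerate-functions h n =
    reindex (finToFun {suc n} {h}) (λ f → funToFin {h} {suc n} f , finToFun-funToFin f)
    where
    reindex : ∀ {c} (φ : Fin c → Fin h → Fin (suc n)) → EnumeratesFunctions h (suc n) φ →
              ∃ λ p → ∃ (EnumeratesFunctions h (suc n) {suc p})
    -- A `node` takes a positive number of children; the constant function rules out an empty
    -- enumeration.
    reindex {zero}  φ onto with () ← proj₁ (onto (λ _ → zero))
    reindex {suc p} φ onto = p , φ , onto

  -- Counting the points missed by a tuple.

  module _ {n w : ℕ} where

    indicator : Fin n → Fin n → ℕ
    indicator x σ = if isYes (x ≟ σ) then w else 0

    sum-map-+ : ∀ (f g : Fin n → ℕ) xs →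
                sum (map (λ x → f x + g x) xs) ≡ sum (map f xs) + sum (map g xs)
    sum-map-+ f g []       = refl
    sum-map-+ f g (x ∷ xs) = trans (cong (f x + g x +_) (sum-map-+ f g xs))
      (interchange (f x) (g x) (sum (map f xs)) (sum (map g xs)))
      where
      interchange : ∀ a b c d → a + b + (c + d) ≡ a + c + (b + d)
      interchange = solve-∀

    sum-indicator-∉ : ∀ x {xs} → ListAll.All (x ≢_) xs → sum (map (indicator x) xs) ≡ 0
    sum-indicator-∉ x []                      = refl
    sum-indicator-∉ x (_∷_ {y} x≢y x∉) with x ≟ y
    ... | yes x≡y = ⊥-elim (x≢y x≡y)
    ... | no  _   = sum-indicator-∉ x x∉

    sum-indicator≤w : ∀ x {xs} → Unique xs → sum (map (indicator x) xs) ≤ w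
    sum-indicator≤w x AllPairs.[]                        = z≤n
    sum-indicator≤w x (AllPairs._∷_ {y} y∉ u) with x ≟ y
    ... | yes refl = ≤-reflexive (trans (cong (w +_) (sum-indicator-∉ x y∉)) (+-identityʳ w))
    ... | no  _    = sum-indicator≤w x u

    -- Induction on `h` gets rid of `g zero` by paying for it: once `w` is added to `f` at that
    -- point, the hypothesis holds for `g ∘ suc`. As the entries of `xs` are distinct, the sum grows
    -- by at most `w`.
    misses-total : ∀ {h} (g : Fin h → Fin n) (f : Fin n → ℕ) →
                   (∀ σ → (∀ i → g i ≢ σ) → w ≤ f σ) → ∀ {xs} → Unique xs →
                   length xs * w ≤ sum (map f xs) + h * w
    misses-total {zero}  g f charged {xs} _ = ≤-trans (each xs) (m≤m+n _ 0)
      where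
      each : ∀ xs → length xs * w ≤ sum (map f xs)
      each []       = z≤n
      each (x ∷ xs) = +-mono-≤ (charged x (λ ())) (each xs)
    misses-total {suc h} g f charged {xs} u = begin
      length xs * w
        ≤⟨ misses-total (g ∘ suc) f′ charged′ u ⟩
      sum (map f′ xs) + h * w
        ≡⟨ cong (_+ h * w) (sum-map-+ f (indicator (g zero)) xs) ⟩
      sum (map f xs) + sum (map (indicator (g zero)) xs) + h * w
        ≤⟨ +-monoˡ-≤ (h * w) (+-monoʳ-≤ (sum (map f xs)) (sum-indicator≤w (g zero) u)) ⟩
      sum (map f xs) + w + h * w
        ≡⟨ +-assoc (sum (map f xs)) w (h * w) ⟩
      sum (map f xs) + suc h * w ∎
      where
      open ≤-Reasoning
      f′ : Fin n → ℕ
      f′ σ = f σ + indicator (g zero) σ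
      charged′ : ∀ σ → (∀ i → g (suc i) ≢ σ) → w ≤ f′ σ
      charged′ σ missed with g zero ≟ σ
      ... | yes _    = m≤n+m w (f σ)
      ... | no  g₀≢σ = ≤-trans (charged σ λ { zero → g₀≢σ ; (suc i) → missed i }) (m≤m+n (f σ) 0)

  -- With `q = ⌊ N /2⌋`, `2 ≤ N` gives `q ≤ h ≤ 2 * q`, so the squares in `(q + h) * (q + h)` are at
  -- most `h * q` and `2 * (h * q)`. The total of five products `h * q` is rounded up to six.
  halves-product : ∀ N → 2 ≤ N → N * N ≤ 3 * (⌈ N /2⌉ * ((N ∸ ⌈ N /2⌉) * 2))
  halves-product N 2≤N = begin
    N * N                      ≡⟨ cong (λ x → x * x) (⌊n/2⌋+⌈n/2⌉≡n N) ⟨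
    (q + h) * (q + h)          ≡⟨ expand q h ⟩
    q * q + 2 * (h * q) + h * h ≤⟨ +-mono-≤ (+-monoˡ-≤ (2 * (h * q)) (*-mono-≤ q≤h (≤-refl {q})))
                                            (*-monoʳ-≤ h (≤-trans h≤1+q 1+q≤q+q)) ⟩
    h * q + 2 * (h * q) + h * (q + q) ≤⟨ m≤m+n _ (h * q) ⟩
    h * q + 2 * (h * q) + h * (q + q) + h * q ≡⟨ collect q h ⟩
    3 * (h * (q * 2))          ≡⟨ cong (λ x → 3 * (h * (x * 2))) q≡N∸h ⟩
    3 * (h * ((N ∸ h) * 2))    ∎
    where
    open ≤-Reasoning
    q = ⌊ N /2⌋
    h = ⌈ N /2⌉
    q≤h : q ≤ h
    q≤h = ⌊n/2⌋≤⌈n/2⌉ N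
    h≤1+q : h ≤ suc q
    -- `h` unfolds to `⌊ suc N /2⌋`, and `suc q` is `⌊ suc (suc N) /2⌋`.
    h≤1+q = ⌊n/2⌋-mono (n≤1+n (suc N))
    1+q≤q+q : suc q ≤ q + q
    1+q≤q+q = +-monoˡ-≤ q (⌊n/2⌋-mono 2≤N)
    q≡N∸h : q ≡ N ∸ h
    q≡N∸h = trans (sym (m+n∸n≡m q h)) (cong (_∸ h) (⌊n/2⌋+⌈n/2⌉≡n N))
    expand : ∀ q h → (q + h) * (q + h) ≡ q * q + 2 * (h * q) + h * h
    expand = solve-∀
    collect : ∀ q h → h * q + 2 * (h * q) + h * (q + q) + h * q ≡ 3 * (h * (q * 2))
    collect = solve-∀

  -- Service costs of fixed routes, in natural numbers.

  module Routes {X I : Set} (d : X → X → ℕ) (K : I → X → Bool) where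

    routeLength : X → List X → ℕ
    routeLength s []       = 0
    routeLength s (x ∷ xs) = d s x + routeLength x xs

    Serves : List I → List X → Set
    Serves = Pointwise (λ i x → T (K i x))

    AtLeast : ℕ → X → List I → Set
    AtLeast c s ρ = ∀ xs → Serves ρ xs → c ≤ routeLength s xs

    Forces : ℕ → List I → Set
    Forces c ρ = ∀ s → AtLeast c s ρ

    Within : ℕ → List I → Set
    Within c ρ = ∀ s → ∃ λ xs → Serves ρ xs × routeLength s xs ≤ c

    split : ∀ ρ {ρ′} s xs → Serves (ρ ++ ρ′) xs → ∃₂ λ ys zs → ∃ λ s′ →
            Serves ρ ys × Serves ρ′ zs × routeLength s xs ≡ routeLength s ys + routeLength s′ zs
    split []      s xs       sv        = [] , xs , s , [] , sv , refl
    split (i ∷ ρ) s (x ∷ xs) (x∈ ∷ sv) =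
      let ys , zs , s′ , sv₁ , sv₂ , eq = split ρ x xs sv
      in x ∷ ys , zs , s′ , x∈ ∷ sv₁ , sv₂ ,
         trans (cong (d s x +_) eq) (sym (+-assoc (d s x) _ _))

    -- The second part begins wherever a route through the first part happens to end, so its bound
    -- has to hold from every start.
    atLeast-++ : ∀ {a b s} ρ {ρ′} → AtLeast a s ρ → Forces b ρ′ → AtLeast (a + b) s (ρ ++ ρ′)
    atLeast-++ ρ lb lb′ xs sv =
      let ys , zs , s′ , sv₁ , sv₂ , eq = split ρ _ xs sv
      in subst (_ ≤_) (sym eq) (+-mono-≤ (lb ys sv₁) (lb′ s′ zs sv₂))

    forces-0 : ∀ ρ → Forces 0 ρ
    forces-0 ρ s xs _ = z≤n

    forces-replicate : ∀ {c ρ} M → Forces c ρ → Forces (M * c) (concat (replicate M ρ))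
    forces-replicate         zero    lb s = forces-0 [] s
    forces-replicate {ρ = ρ} (suc M) lb s = atLeast-++ ρ (lb s) (forces-replicate M lb)

    -- The other blocks are only bounded by 0: a child that rejects a single part of a kind already
    -- has to pay for the whole round.
    forces-concatMap : ∀ {J : Set} {c} (f : J → List I) {j js} → j ∈ js →
                       Forces c (f j) → Forces c (concatMap f js)
    forces-concatMap f {js = j ∷ js} (here refl) lb s =
      subst (λ c → AtLeast c s _) (+-identityʳ _)
        (atLeast-++ (f j) (lb s) (forces-0 (concatMap f js)))
    forces-concatMap f {js = j ∷ js} (there j∈) lb s =
      atLeast-++ (f j) (forces-0 (f j) s) (forces-concatMap f j∈ lb)

    within-[] : Within 0 []
    within-[] s = [] , [] , z≤n

    last : X → List X → X
    last s []       = s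
    last s (x ∷ xs) = last x xs

    routeLength-++ : ∀ s xs ys →
      routeLength s (xs ++ ys) ≡ routeLength s xs + routeLength (last s xs) ys
    routeLength-++ s []       ys = refl
    routeLength-++ s (x ∷ xs) ys = trans
      (cong (d s x +_) (routeLength-++ x xs ys))
      (sym (+-assoc (d s x) _ _))

    within-++ : ∀ {a b ρ ρ′} → Within a ρ → Within b ρ′ → Within (a + b) (ρ ++ ρ′)
    within-++ ub ub′ s =
      let xs , sv , le   = ub s
          ys , sv′ , le′ = ub′ (last s xs)
      in xs ++ ys , Pointwise.++⁺ sv sv′ ,
         subst (_≤ _) (sym (routeLength-++ s xs ys)) (+-mono-≤ le le′)

    within-weaken : ∀ {a b ρ} → a ≤ b → Within a ρ → Within b ρ
    within-weaken a≤b ub s = let xs , sv , le = ub s in xs , sv , ≤-trans le a≤b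

    within-replicate : ∀ {c ρ} M → Within c ρ → Within (M * c) (concat (replicate M ρ))
    within-replicate zero    ub = within-[]
    within-replicate (suc M) ub = within-++ ub (within-replicate M ub)

    within-concatMap : ∀ {J : Set} {c} (f : J → List I) {js} →
                       ListAll.All (λ j → Within c (f j)) js →
                       Within (length js * c) (concatMap f js)
    within-concatMap f []         = within-[]
    within-concatMap f (ub ∷ ubs) = within-++ ub (within-concatMap f ubs)

  -- Routes in trees with natural edge weights.

  module Trees {a ℓ₁ ℓ₂ : Level} (𝔽 : ArchimedeanOrderedField a ℓ₁ ℓ₂) where

    open MSS 𝔽 using (Tree; leaf; node; Leaf)

    -- `depthℕ` and `distℕ` copy `depth` and `dist`, so that all estimates of weights take place in
    -- ℕ; `dist-fromℕ` carries them over to the field.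
    depthℕ : ∀ {k} → Vec ℕ k → ℕ
    depthℕ = Vec.foldr′ _+_ 0

    distℕ : ∀ {k} → Vec ℕ k → (t : Tree k) → Leaf t → Leaf t → ℕ
    distℕ []       leaf        _       _       = 0
    distℕ (w ∷ ws) (node n ts) (i , x) (j , y) with i ≟ j
    ... | yes refl = distℕ ws (ts i) x y
    ... | no  _    = 2 * depthℕ (w ∷ ws)

    distℕ≤2depth : ∀ {k} (ws : Vec ℕ k) t x y → distℕ ws t x y ≤ 2 * depthℕ ws
    distℕ≤2depth []       leaf        _       _       = z≤n
    distℕ≤2depth (w ∷ ws) (node n ts) (i , x) (j , y) with i ≟ j
    ... | yes refl = ≤-trans (distℕ≤2depth ws (ts i) x y) (*-monoʳ-≤ 2 (m≤n+m _ w))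
    ... | no  _    = ≤-refl

    firstLeaf : ∀ {k} (t : Tree k) → Leaf t
    firstLeaf leaf        = tt
    firstLeaf (node n ts) = zero , firstLeaf (ts zero)

    module Children {k : ℕ} (w : ℕ) (ws : Vec ℕ k) (t : Tree k) {p : ℕ} {I : Set}
      (K : I → Fin (suc p) × Leaf t → Bool) where

      private
        module N = Routes (distℕ (w ∷ ws) (node p (λ _ → t))) K
        module Ch (a : Fin (suc p)) = Routes (distℕ ws t) (λ i x → K i (a , x))

      stay-or-leave : ∀ a x xs → 2 * depthℕ (w ∷ ws) ≤ N.routeLength (a , x) xs ⊎
        (∃ λ ys → xs ≡ map (a ,_) ys × N.routeLength (a , x) xs ≡ Ch.routeLength a x ys)
      stay-or-leave a x []             = inj₂ ([] , refl , refl)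
      stay-or-leave a x ((b , y) ∷ xs) with a ≟ b
      ... | no  _    = inj₁ (m≤m+n _ _)
      ... | yes refl with stay-or-leave a y xs
      ...   | inj₁ le              = inj₁ (≤-trans le (m≤n+m _ _))
      ...   | inj₂ (ys , refl , eq) = inj₂ (y ∷ ys , refl , cong (distℕ ws t x y +_) eq)

      serves-child : ∀ {a ρ} ys → N.Serves ρ (map (a ,_) ys) → Ch.Serves a ρ ys
      serves-child []       []        = []
      serves-child (y ∷ ys) (y∈ ∷ sv) = y∈ ∷ serves-child ys sv

      serves-node : ∀ {a ρ ys} → Ch.Serves a ρ ys → N.Serves ρ (map (a ,_) ys)
      serves-node []        = []
      serves-node (y∈ ∷ sv) = y∈ ∷ serves-node sv

      -- The bound is exactly the diameter of the node: a route that ever leaves the child pays it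
      -- in that one move, and a route that stays pays it by hypothesis.
      atLeast-node : ∀ {a ρ} → Ch.Forces a (2 * depthℕ (w ∷ ws)) ρ →
                     ∀ x → N.AtLeast (2 * depthℕ (w ∷ ws)) (a , x) ρ
      atLeast-node lb x xs sv with stay-or-leave _ x xs
      ... | inj₁ le               = le
      ... | inj₂ (ys , refl , eq) = subst (_ ≤_) (sym eq) (lb x ys (serves-child ys sv))

      routeLength-node : ∀ a x ys → N.routeLength (a , x) (map (a ,_) ys) ≡ Ch.routeLength a x ys
      routeLength-node a x []       = refl
      routeLength-node a x (y ∷ ys) with a ≟ a
      ... | yes refl = cong (distℕ ws t x y +_) (routeLength-node a y ys)
      ... | no  a≢a  = ⊥-elim (a≢a refl)

      -- The route enters `a` at the first state of a route for the child. The start `firstLeaf t`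
      -- of the latter is a dummy: its first step is dropped in favour of a direct move from `s`,
      -- which costs at most the diameter.
      within-node : ∀ {a c ρ} → Ch.Within a c ρ → N.Within (2 * depthℕ (w ∷ ws) + c) ρ
      within-node {a} ub s with ub (firstLeaf t)
      ... | []     , sv , le = [] , serves-node sv , z≤n
      ... | y ∷ ys , sv , le = map (a ,_) (y ∷ ys) , serves-node sv ,
        +-mono-≤ (distℕ≤2depth (w ∷ ws) (node p (λ _ → t)) s (a , y))
          (≤-trans (≤-reflexive (routeLength-node a y ys)) (≤-trans (m≤n+m _ _) le))

    -- Subtrees that accept a prescribed set of kinds.

    module Gadgets (n : ℕ → ℕ) (𝓑 : ∀ j → Antichain (suc (n (suc j))) (suc (n j))) where

      -- `n j` is one less than the number of kinds, matching `node (n (suc j))`, which has one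
      -- child for each kind of level `suc j`.
      Kind : ℕ → Set
      Kind j = Fin (suc (n j))

      module B (j : ℕ) = Antichain (𝓑 j)

      shape : ∀ j → Tree j
      shape zero    = leaf
      shape (suc j) = node (n (suc j)) (λ _ → shape j)

      -- The shape does not depend on the set F of accepted kinds: a child a ∉ F is
      -- present but accepts nothing, a child a ∈ F accepts the set a.
      label : ∀ j → (Kind j → Bool) → Kind 0 → Leaf (shape j) → Bool
      label zero    F i _       = F i
      label (suc j) F i (a , x) = label j (λ y → F a ∧ B.member j a y) i x

      -- scale j L is the depth of a level-j subtree including the edge above it.
      -- The parameter L says that serving an accepted kind inside the subtree costs
      -- at most scale j L / L (slack≤scale); it grows towards the leaves because a
      -- request of level j + 1 repeats up to suc (n j) kinds 4 L + 2 times.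
      below : ℕ → ℕ → ℕ
      below j L = 2 * (suc (n j) * L)

      scale : ℕ → ℕ → ℕ
      scale zero    L = 1
      scale (suc j) L = (4 * L + 2) * scale j (below j L)

      -- Of the `4 * L + 2` copies of `scale j (below j L)` that make up `scale (suc j) L`, one is
      -- the depth inside the subtree; the edge above it gets the others.
      weight : ℕ → ℕ → ℕ
      weight zero    L = 1
      weight (suc j) L = (4 * L + 1) * scale j (below j L)

      weightsBelow : ∀ j → ℕ → Vec ℕ j
      weightsBelow zero    L = []
      weightsBelow (suc j) L = weight j (below j L) ∷ weightsBelow j (below j L)

      depth≡scale : ∀ j L → depthℕ (weight j L ∷ weightsBelow j L) ≡ scale j L
      depth≡scale zero    L = refl
      depth≡scale (suc j) L = trans
        (cong ((4 * L + 1) * scale j (below j L) +_) (depth≡scale j (below j L)))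
        (lemma L (scale j (below j L)))
        where
        lemma : ∀ L x → (4 * L + 1) * x + x ≡ (4 * L + 2) * x
        lemma = solve-∀

      parts : ∀ j → Kind (suc j) → List (Kind j)
      parts j σ = filter (T? ∘ B.member j σ) (allFin (suc (n j)))

      length-parts : ∀ j σ → length (parts j σ) ≤ suc (n j)
      length-parts j σ = ≤-trans
        (length-filter (T? ∘ B.member j σ) (allFin (suc (n j))))
        (≤-reflexive (length-tabulate {n = suc (n j)} id))

      -- The `4 * L + 2` rounds, each forcing `2 * scale j (below j L)` in a rejecting subtree, add
      -- up to `2 * scale (suc j) L`, the price of leaving that subtree.
      requests : (j L : ℕ) → Kind j → List (Kind 0)
      requests zero    L σ = σ ∷ []
      requests (suc j) L σ =
        concat (replicate (4 * L + 2) (concatMap (requests j (below j L)) (parts j σ)))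

      slack : ℕ → ℕ → ℕ
      slack zero    L = 0
      slack (suc j) L =
        2 * scale j (below j L) + (4 * L + 2) * (suc (n j) * slack j (below j L))

      -- Each term of `slack` takes half of `scale`, hence the doubling. Entering the child costs
      -- `2 * D`, and `4 * L ≤ 4 * L + 2`; for the rounds, the induction hypothesis at `below j L`
      -- gives `2 * (N * L) * s ≤ D`.
      slack≤scale : ∀ j L → L * slack j L ≤ scale j L
      slack≤scale zero    L = ≤-trans (≤-reflexive (*-zeroʳ L)) z≤n
      slack≤scale (suc j) L = *-cancelˡ-≤ 2 (begin
        2 * (L * (2 * D + (4 * L + 2) * (N * s)))     ≡⟨ expand L D N s ⟩
        4 * L * D + (4 * L + 2) * (2 * (N * L) * s)   ≤⟨ +-mono-≤ (*-monoˡ-≤ D (m≤m+n (4 * L) 2))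
                                                         (*-monoʳ-≤ (4 * L + 2) (slack≤scale j (below j L))) ⟩
        (4 * L + 2) * D + (4 * L + 2) * D             ≡⟨ double ((4 * L + 2) * D) ⟩
        2 * ((4 * L + 2) * D)                         ∎)
        where
        open ≤-Reasoning
        D = scale j (below j L)
        N = suc (n j)
        s = slack j (below j L)
        expand : ∀ L D N s → 2 * (L * (2 * D + (4 * L + 2) * (N * s))) ≡
                             4 * L * D + (4 * L + 2) * (2 * (N * L) * s)
        expand = solve-∀
        double : ∀ x → x + x ≡ 2 * x
        double = solve-∀

      module Gadget (j L : ℕ) (F : Kind j → Bool) =
        Routes (distℕ (weightsBelow j L) (shape j)) (label j F)
      open Gadget using (Forces; Within)

      -- At a leaf the bound is vacuous, as the request cannot be served there at all. Higher up,
      -- every child rejects some part of `σ`, so by induction each round costs as much as changing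
      -- the child, from whatever state it starts.
      reject : ∀ (j L : ℕ) (F : Kind j → Bool) (σ : Kind j) →
               ¬ T (F σ) → Forces j L F (2 * scale j L) (requests j L σ)
      reject zero    L F σ σ∉F s (x ∷ xs) (σ∈F ∷ _) = ⊥-elim (σ∉F σ∈F)
      reject (suc j) L F σ σ∉F = subst (λ c → Forces (suc j) L F c (requests (suc j) L σ))
        (rearrange (4 * L + 2) (scale j L′))
        (Gadget.forces-replicate (suc j) L F (4 * L + 2) roundForces)
        where
        L′ : ℕ
        L′ = below j L

        rearrange : ∀ M D → M * (2 * D) ≡ 2 * (M * D)
        rearrange = solve-∀

        open Children (weight j L′) (weightsBelow j L′) (shape j) {n (suc j)} (label (suc j) F)

        -- A child outside `F` accepts nothing, so any member of `σ` will do. A child in `F` differs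
        -- from `σ`, which is not in `F`, and the antichain supplies a member that it misses.
        unavailable : ∀ a → ∃ λ x → T (B.member j σ x) × ¬ T (F a ∧ B.member j a x)
        unavailable a with T? (F a)
        ... | no  a∉F = let x , x∈ = B.nonempty j σ in
          x , x∈ , λ t → a∉F (proj₁ (Equivalence.to T-∧ t))
        ... | yes a∈F =
          let x , x∈σ , x∉a = B.separates j {σ} {a} λ { refl → σ∉F a∈F }
          in x , x∈σ , λ t → x∉a (proj₂ (Equivalence.to (T-∧ {F a}) t))

        round : List (Kind 0)
        round = concatMap (requests j L′) (parts j σ)

        roundInChild : ∀ a → Forces j L′ (λ y → F a ∧ B.member j a y) (2 * scale j L′) round
        roundInChild a = let y , y∈σ , y∉ = unavailable a in
          Gadget.forces-concatMap j L′ _ (requests j L′)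
            (∈-filter⁺ (T? ∘ B.member j σ) (∈-allFin y) y∈σ)
            (reject j L′ _ y y∉)

        roundForces : Forces (suc j) L F (2 * scale j L′) round
        roundForces (a , x) = subst (λ c → Gadget.AtLeast (suc j) L F (2 * c) (a , x) round)
          (depth≡scale j L′)
          (atLeast-node {a} (subst (λ c → Forces j L′ (λ y → F a ∧ B.member j a y) (2 * c) round)
            (sym (depth≡scale j L′)) (roundInChild a)) x)

      -- The child with index `σ` accepts every part of `σ`. It is entered once, and all rounds are
      -- served inside it.
      accept : ∀ (j L : ℕ) (F : Kind j → Bool) (σ : Kind j) →
               T (F σ) → Within j L F (slack j L) (requests j L σ)
      accept zero    L F σ σ∈F s = tt ∷ [] , σ∈F ∷ [] , z≤n
      accept (suc j) L F σ σ∈F = subst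
        (λ c → Within (suc j) L F (2 * c + (4 * L + 2) * (suc (n j) * slack j L′))
                 (requests (suc j) L σ))
        (depth≡scale j L′)
        (within-node {a = σ} (Gadget.within-replicate j L′ G (4 * L + 2)
          (Gadget.within-weaken j L′ G (*-monoˡ-≤ (slack j L′) (length-parts j σ))
            (Gadget.within-concatMap j L′ G (requests j L′)
              (ListAll.map (λ {x} x∈σ → accept j L′ G x (Equivalence.from T-∧ (σ∈F , x∈σ)))
                (ListAllₚ.all-filter (T? ∘ B.member j σ) (allFin (suc (n j)))))))))
        where
        L′ : ℕ
        L′ = below j L

        G : Kind j → Bool
        G y = F σ ∧ B.member j σ y

        open Children (weight j L′) (weightsBelow j L′) (shape j) {n (suc j)} (label (suc j) F)

      -- This makes the request types non-empty. The kind is fixed before `F`, so that the root can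
      -- then look for a child accepting it.
      available : ∀ j i → ∃ λ σ → ∀ F → T (F σ) → ∃ λ x → T (label j F i x)
      available zero    i = i , λ F t → tt , t
      available (suc j) i =
        let σ , leafFor = available j i
            a , σ∈a     = B.covers j σ
        in a , λ F t → let x , ok = leafFor _ (Equivalence.from T-∧ (t , σ∈a)) in (a , x) , ok

      weight-pos : ∀ j L → 0 < weight j L
      scale-pos  : ∀ j L → 0 < scale j L
      weight-pos zero    L = s≤s z≤n
      weight-pos (suc j) L = *-mono-≤ (m≤n+m 1 (4 * L)) (scale-pos j (below j L))
      scale-pos zero    L = s≤s z≤n
      scale-pos (suc j) L = *-mono-≤ (m≤n⇒m≤o+n (4 * L) (s≤s z≤n)) (scale-pos j (below j L))

      weightsBelow-pos : ∀ j L → All (0 <_) (weightsBelow j L)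
      weightsBelow-pos zero    L = []
      weightsBelow-pos (suc j) L = weight-pos j (below j L) ∷ weightsBelow-pos j (below j L)

      -- The root, with one child for every choice of `h` kinds.

      module Root (j h : ℕ) where

        private
          p : ℕ
          p = proj₁ (enumerate-functions h (n j))

          W : ℕ
          -- The parameter `L` is set to `h`, so that the slack of the `h` requests of one phase is
          -- at most `W` altogether.
          W = scale j h

        choice : Fin (suc p) → Fin h → Kind j
        choice = proj₁ (proj₂ (enumerate-functions h (n j)))

        choice-onto : EnumeratesFunctions h (suc (n j)) choice
        choice-onto = proj₂ (proj₂ (enumerate-functions h (n j)))

        accepts : Fin (suc p) → Kind j → Bool
        accepts c σ = isYes (any? λ i → choice c i ≟ σ)

        rootTree : Tree (suc j)
        rootTree = node p (λ _ → shape j)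

        rootWeights : Vec ℕ (suc j)
        rootWeights = weight j h ∷ weightsBelow j h

        rootWeights-pos : All (0 <_) rootWeights
        rootWeights-pos = weight-pos j h ∷ weightsBelow-pos j h

        rootLabel : Kind 0 → Leaf rootTree → Bool
        rootLabel i (c , x) = label j (accepts c) i x

        rootLabel-nonEmpty : 0 < h → ∀ i → ∃ λ x → T (rootLabel i x)
        rootLabel-nonEmpty 0<h i with available j i
        ... | σ , leafFor with choice-onto (λ _ → σ)
        ...   | c , c≡σ =
          let x , ok = leafFor (accepts c) (fromWitness (fromℕ< 0<h , c≡σ (fromℕ< 0<h)))
          in (c , x) , ok

        module Route = Routes (distℕ rootWeights rootTree) rootLabel
        open Children (weight j h) (weightsBelow j h) (shape j) {p} rootLabel

        loss : Leaf rootTree → Kind j → ℕ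
        loss (c , _) σ = if accepts c σ then 0 else 2 * W

        loss-forced : ∀ s σ → Route.AtLeast (loss s σ) s (requests j h σ)
        loss-forced (c , x) σ with accepts c σ in eq
        ... | true  = λ _ _ → z≤n
        ... | false = subst (λ w → Route.AtLeast (2 * w) (c , x) (requests j h σ)) (depth≡scale j h)
          (atLeast-node {c} (subst
            (λ w → Gadget.Forces j h (accepts c) (2 * w) (requests j h σ)) (sym (depth≡scale j h))
            (reject j h (accepts c) σ (subst T eq))) x)

        -- The choice of `c` hits at most `h` kinds, and `misses-total` charges `2 * W` for each of
        -- the rest.
        loss-total : ∀ s → (suc (n j) ∸ h) * (2 * W) ≤ sum (map (loss s) (allFin (suc (n j))))
        loss-total (c , x) = ≤-trans
          (≤-reflexive (*-distribʳ-∸ (2 * W) (suc (n j)) h))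
          (m≤n+o⇒m∸n≤o _ (h * (2 * W)) (begin
            suc (n j) * (2 * W)
              ≡⟨ cong (_* (2 * W)) (length-tabulate {n = suc (n j)} id) ⟨
            length (allFin (suc (n j))) * (2 * W)
              ≤⟨ misses-total (choice c) (loss (c , x)) charged (Uniqueₚ.allFin⁺ (suc (n j))) ⟩
            sum (map (loss (c , x)) (allFin (suc (n j)))) + h * (2 * W)
              ≡⟨ +-comm _ (h * (2 * W)) ⟩
            h * (2 * W) + sum (map (loss (c , x)) (allFin (suc (n j)))) ∎))
          where
          open ≤-Reasoning

          charged : ∀ σ → (∀ i → choice c i ≢ σ) → 2 * W ≤ loss (c , x) σ
          charged σ missed with any? (λ i → choice c i ≟ σ)
          ... | yes (i , hit) = ⊥-elim (missed i hit)
          ... | no  _         = ≤-refl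

        -- The kinds of the phase, repetitions included, are the choice of some child. Moving there
        -- costs at most `2 * W`, and serving the whole phase there at most another `W`.
        phase-within : ∀ (σs : Vec (Kind j) h) →
                       Route.Within (3 * W) (concatMap (requests j h) (toList σs))
        phase-within σs with choice-onto (lookup σs)
        ... | c , c≡σs = Route.within-weaken bound (within-node {a = c}
          (Gadget.within-concatMap j h (accepts c) (requests j h)
            (VecAllₚ.toList⁺ (VecAllₚ.lookup⁻ {xs = σs} λ i →
              accept j h (accepts c) (lookup σs i) (fromWitness (i , c≡σs i))))))
          where
          open ≤-Reasoning
          bound : 2 * depthℕ rootWeights + length (toList σs) * slack j h ≤ 3 * W
          bound = begin
            2 * depthℕ rootWeights + length (toList σs) * slack j h
              ≡⟨ cong₂ (λ w l → 2 * w + l * slack j h) (depth≡scale j h) (length-toList σs) ⟩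
            2 * W + h * slack j h ≤⟨ +-monoʳ-≤ (2 * W) (slack≤scale j h) ⟩
            2 * W + W             ≡⟨ +-comm (2 * W) W ⟩
            3 * W                 ∎

-- Arithmetic in an Archimedean ordered field.

module OrderedFieldProperties {a ℓ₁ ℓ₂ : Level} (𝔽 : ArchimedeanOrderedField a ℓ₁ ℓ₂) where

  open ArchimedeanOrderedField 𝔽
  open CommutativeRing commutativeRing
    using (+-congˡ; +-congʳ; *-cong; *-congˡ; *-congʳ; *-comm; *-assoc; *-identityˡ; *-identityʳ;
           distribˡ; distribʳ; zeroˡ; zeroʳ; -‿cong; commutativeSemiring)
  open RingProperties (CommutativeRing.ring commutativeRing) using (-‿distribˡ-*; -‿involutive)
  open GroupProperties (CommutativeRing.+-group commutativeRing)
    using () renaming (//-rightDividesʳ to x+y-y≈x; //-rightDividesˡ to x-y+y≈x)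
  open SemiringMult semiring using (×-homo-+; ×1-homo-*)
  open NatSolver commutativeSemiring using (solve; _:+_; _:*_; _:=_)
  open PosetReasoning (TotalOrder.poset totalOrder)

  +-monoˡ-≤ : ∀ x {y z} → y ≤ z → y + x ≤ z + x
  +-monoˡ-≤ x {y} {z} y≤z = begin
    y + x ≈⟨ +-comm y x ⟩
    x + y ≤⟨ +-monoʳ-≤ x y≤z ⟩
    x + z ≈⟨ +-comm x z ⟩
    z + x ∎

  +-mono-≤ : ∀ {x y u v} → x ≤ y → u ≤ v → x + u ≤ y + v
  +-mono-≤ {x} {y} {u} {v} x≤y u≤v = ≤-trans (+-monoʳ-≤ x u≤v) (+-monoˡ-≤ v x≤y)

  +-cancelʳ-≤ : ∀ z {x y} → x + z ≤ y + z → x ≤ y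
  +-cancelʳ-≤ z {x} {y} le = begin
    x               ≈⟨ x+y-y≈x z x ⟨
    x + z + - z     ≤⟨ +-monoˡ-≤ (- z) le ⟩
    y + z + - z     ≈⟨ x+y-y≈x z y ⟩
    y               ∎

  x≤y+z⇒x-y≤z : ∀ {x y z} → x ≤ y + z → x + - y ≤ z
  x≤y+z⇒x-y≤z {x} {y} {z} le = +-cancelʳ-≤ y (begin
    x + - y + y ≈⟨ x-y+y≈x y x ⟩
    x           ≤⟨ le ⟩
    y + z       ≈⟨ +-comm y z ⟩
    z + y       ∎)

  x-y≤z⇒x≤y+z : ∀ {x y z} → x + - y ≤ z → x ≤ y + z
  x-y≤z⇒x≤y+z {x} {y} {z} le = begin
    x           ≈⟨ x-y+y≈x y x ⟨
    x + - y + y ≤⟨ +-monoˡ-≤ y le ⟩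
    z + y       ≈⟨ +-comm z y ⟩
    y + z       ∎

  y≤x⇒0≤x-y : ∀ {x y} → y ≤ x → 0# ≤ x + - y
  y≤x⇒0≤x-y {x} {y} le = +-cancelʳ-≤ y (begin
    0# + y      ≈⟨ +-identityˡ y ⟩
    y           ≤⟨ le ⟩
    x           ≈⟨ x-y+y≈x y x ⟨
    x + - y + y ∎)

  *-monoʳ-≤ : ∀ {x y z} → 0# ≤ x → y ≤ z → x * y ≤ x * z
  *-monoʳ-≤ {x} {y} {z} 0≤x y≤z = begin
    x * y                       ≈⟨ +-identityʳ (x * y) ⟨
    x * y + 0#                  ≤⟨ +-monoʳ-≤ (x * y) (*-nonNeg 0≤x (y≤x⇒0≤x-y y≤z)) ⟩
    x * y + x * (z + - y)       ≈⟨ distribˡ x y (z + - y) ⟨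
    x * (y + (z + - y))         ≈⟨ *-congˡ (trans (+-comm y _) (x-y+y≈x y z)) ⟩
    x * z                       ∎

  *-monoˡ-≤ : ∀ {x y z} → 0# ≤ x → y ≤ z → y * x ≤ z * x
  *-monoˡ-≤ {x} {y} {z} 0≤x y≤z = begin
    y * x ≈⟨ *-comm y x ⟩
    x * y ≤⟨ *-monoʳ-≤ 0≤x y≤z ⟩
    x * z ≈⟨ *-comm x z ⟩
    z * x ∎

  0≤1 : 0# ≤ 1#
  0≤1 with ≤-total 0# 1#
  ... | inj₁ 0≤1 = 0≤1
  ... | inj₂ 1≤0 = begin
    0#            ≤⟨ *-nonNeg 0≤-1 0≤-1 ⟩
    - 1# * - 1#   ≈⟨ -‿distribˡ-* 1# (- 1#) ⟨
    - (1# * - 1#) ≈⟨ -‿cong (*-identityˡ (- 1#)) ⟩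
    - - 1#        ≈⟨ -‿involutive 1# ⟩
    1#            ∎
    where
    0≤-1 : 0# ≤ - 1#
    0≤-1 = ≤-trans (y≤x⇒0≤x-y 1≤0) (≤-reflexive (+-identityˡ (- 1#)))

  fromℕ-+ : ∀ m n → fromℕ (m ℕ.+ n) ≈ fromℕ m + fromℕ n
  fromℕ-+ = ×-homo-+ 1#

  fromℕ-* : ∀ m n → fromℕ (m ℕ.* n) ≈ fromℕ m * fromℕ n
  fromℕ-* = ×1-homo-*

  fromℕ-nonNeg : ∀ n → 0# ≤ fromℕ n
  fromℕ-nonNeg zero    = ≤-refl
  fromℕ-nonNeg (suc n) =
    ≤-trans (≤-reflexive (sym (+-identityˡ 0#))) (+-mono-≤ 0≤1 (fromℕ-nonNeg n))

  fromℕ-mono : ∀ {m n} → m ℕ.≤ n → fromℕ m ≤ fromℕ n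
  fromℕ-mono {n = n} z≤n = fromℕ-nonNeg n
  fromℕ-mono (s≤s m≤n)   = +-monoʳ-≤ 1# (fromℕ-mono m≤n)

  0<fromℕ : ∀ {n} → 0 ℕ.< n → 0# < fromℕ n
  0<fromℕ {suc n} _ = fromℕ-nonNeg (suc n) , λ 0≈n → 0≉1 (≤-antisym 0≤1 (begin
    1#            ≈⟨ +-identityʳ 1# ⟨
    1# + 0#       ≤⟨ +-monoʳ-≤ 1# (fromℕ-nonNeg n) ⟩
    1# + fromℕ n  ≈⟨ 0≈n ⟨
    0#            ∎))

  -- By totality only `z ≤ y` is left to treat; there both products coincide and the inverse is
  -- applied to an equation, so its sign does not matter.
  *-cancelˡ-≤ : ∀ {x y z} → 0# < x → x * y ≤ x * z → y ≤ z
  *-cancelˡ-≤ {x} {y} {z} (0≤x , 0≉x) le with ≤-total y z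
  ... | inj₁ y≤z = y≤z
  ... | inj₂ z≤y = ≤-reflexive (trans (undo y) (trans (*-congʳ xy≈xz) (sym (undo z))))
    where
    inv = invertible x (0≉x ∘ sym)
    x⁻¹ = proj₁ inv

    xy≈xz : x * y ≈ x * z
    xy≈xz = ≤-antisym le (*-monoʳ-≤ 0≤x z≤y)

    undo : ∀ y → y ≈ x * y * x⁻¹
    undo y = trans (sym (*-identityˡ y)) (trans (*-congʳ (sym (proj₂ inv)))
      (solve 3 (λ x x′ y → x :* x′ :* y := x :* y :* x′) refl x x⁻¹ y))

  suc-* : ∀ n x → x + fromℕ n * x ≈ fromℕ (suc n) * x
  suc-* n x = trans (+-congʳ (sym (*-identityˡ x))) (sym (distribʳ x 1# (fromℕ n)))

  -- If `x` is positive, the Archimedean property gives `n` above `z * x⁻¹`; then `suc n` copies of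
  -- `x` are at most `z`, which is at most `n` copies.
  multiples-unbounded : ∀ {x z} → 0# ≤ x → (∀ n → fromℕ n * x ≤ z) → x ≤ 0#
  multiples-unbounded {x} {z} 0≤x bounded with x ≤? 0#
  ... | yes x≤0 = x≤0
  ... | no  x≰0 = +-cancelʳ-≤ (fromℕ n * x) (begin
    x + fromℕ n * x        ≈⟨ suc-* n x ⟩
    fromℕ (suc n) * x      ≤⟨ bounded (suc n) ⟩
    z                      ≈⟨ *-identityʳ z ⟨
    z * 1#                 ≈⟨ *-congˡ (proj₂ inv) ⟨
    z * (x * x⁻¹)          ≈⟨ solve 3 (λ z x x′ → z :* (x :* x′) := z :* x′ :* x) refl z x x⁻¹ ⟩
    z * x⁻¹ * x            ≤⟨ *-monoˡ-≤ 0≤x (proj₂ above) ⟩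
    fromℕ n * x            ≈⟨ +-identityˡ (fromℕ n * x) ⟨
    0# + fromℕ n * x       ∎)
    where
    inv   = invertible x (x≰0 ∘ ≤-reflexive)
    x⁻¹   = proj₁ inv
    above = archimedean (z * x⁻¹)
    n     = proj₁ above

  -- This removes the additive constant of a competitive ratio: over many phases it becomes
  -- negligible.
  drop-constant : ∀ {x y z} → (∀ n → fromℕ n * x ≤ fromℕ n * y + z) → x ≤ y
  drop-constant {x} {y} {z} hyp with ≤-total x y
  ... | inj₁ x≤y = x≤y
  ... | inj₂ y≤x = ≤-trans
    (x-y≤z⇒x≤y+z (multiples-unbounded (y≤x⇒0≤x-y y≤x) λ n → +-cancelʳ-≤ (fromℕ n * y) (begin
      fromℕ n * (x + - y) + fromℕ n * y ≈⟨ distribˡ (fromℕ n) (x + - y) y ⟨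
      fromℕ n * (x + - y + y)           ≈⟨ *-congˡ (x-y+y≈x y x) ⟩
      fromℕ n * x                       ≤⟨ hyp n ⟩
      fromℕ n * y + z                   ≈⟨ +-comm _ z ⟩
      z + fromℕ n * y                   ∎)))
    (≤-reflexive (+-identityʳ y))

  -- Finite sums.

  ∑[_] : ∀ {b} {B : Set b} → List B → (B → Carrier) → Carrier
  ∑[ xs ] f = foldr _+_ 0# (map f xs)

  module _ {b} {B : Set b} where

    ∑-mono : ∀ (xs : List B) {f g : B → Carrier} → (∀ x → f x ≤ g x) → ∑[ xs ] f ≤ ∑[ xs ] g
    ∑-mono []       f≤g = ≤-refl
    ∑-mono (x ∷ xs) f≤g = +-mono-≤ (f≤g x) (∑-mono xs f≤g)

    ∑-cong : ∀ (xs : List B) {f g : B → Carrier} → (∀ x → f x ≈ g x) → ∑[ xs ] f ≈ ∑[ xs ] g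
    ∑-cong []       f≈g = refl
    ∑-cong (x ∷ xs) f≈g = +-cong (f≈g x) (∑-cong xs f≈g)

    ∑-+ : ∀ (xs : List B) (f g : B → Carrier) → ∑[ xs ] (λ x → f x + g x) ≈ ∑[ xs ] f + ∑[ xs ] g
    ∑-+ []       f g = sym (+-identityˡ 0#)
    ∑-+ (x ∷ xs) f g = trans (+-congˡ (∑-+ xs f g))
      (solve 4 (λ a b c d → (a :+ b) :+ (c :+ d) := (a :+ c) :+ (b :+ d)) refl _ _ _ _)

    ∑-*ʳ : ∀ (xs : List B) (f : B → Carrier) c → ∑[ xs ] (λ x → f x * c) ≈ ∑[ xs ] f * c
    ∑-*ʳ []       f c = sym (zeroˡ c)
    ∑-*ʳ (x ∷ xs) f c = trans (+-congˡ (∑-*ʳ xs f c)) (sym (distribʳ c (f x) _))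

    ∑-const : ∀ (xs : List B) c → ∑[ xs ] (λ _ → c) ≈ fromℕ (length xs) * c
    ∑-const []       c = sym (zeroˡ c)
    ∑-const (x ∷ xs) c = trans (+-congˡ (∑-const xs c)) (suc-* (length xs) c)

    ∑-fromℕ : ∀ (xs : List B) (f : B → ℕ) →
              ∑[ xs ] (fromℕ ∘ f) ≈ fromℕ (sum (map f xs))
    ∑-fromℕ []       f = refl
    ∑-fromℕ (x ∷ xs) f = trans (+-congˡ (∑-fromℕ xs f)) (sym (fromℕ-+ (f x) _))

    -- Exchange of summation: it moves the sum over the adversary's kinds past the expectation over
    -- the next state.
    ∑-average : ∀ {e} {E : Set e}
                (xs : List B) (ys : List E) (p : B → Carrier) (f : B → E → Carrier) →
                ∑[ ys ] (λ y → ∑[ xs ] λ x → p x * f x y) ≈ ∑[ xs ] (λ x → p x * ∑[ ys ] (f x))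
    ∑-average xs []       p f = sym (trans (∑-cong xs (λ x → zeroʳ (p x)))
      (trans (∑-const xs 0#) (zeroʳ _)))
    ∑-average xs (y ∷ ys) p f = trans (+-congˡ (∑-average xs ys p f))
      (trans (sym (∑-+ xs _ _)) (∑-cong xs (λ x → sym (distribˡ (p x) _ _))))

    -- The averaging argument; `y` is a maximiser of `f`, found by comparing the head with the
    -- maximiser of the tail.
    ∑≤length*max : ∀ x (xs : List B) (f : B → Carrier) →
                   ∃ λ y → ∑[ x ∷ xs ] f ≤ fromℕ (length (x ∷ xs)) * f y
    ∑≤length*max x []        f = x , ≤-reflexive (sym (trans (*-congʳ (+-identityʳ 1#))
      (trans (*-identityˡ _) (sym (+-identityʳ _)))))
    ∑≤length*max x (x′ ∷ xs) f with ∑≤length*max x′ xs f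
    ... | y , le with ≤-total (f x) (f y)
    ...   | inj₁ x≤y = y , (begin
      f x + ∑[ x′ ∷ xs ] f                       ≤⟨ +-mono-≤ x≤y le ⟩
      f y + fromℕ (length (x′ ∷ xs)) * f y       ≈⟨ suc-* (length (x′ ∷ xs)) (f y) ⟩
      fromℕ (length (x ∷ x′ ∷ xs)) * f y         ∎)
    ...   | inj₂ y≤x = x , (begin
      f x + ∑[ x′ ∷ xs ] f                       ≤⟨ +-monoʳ-≤ (f x) (≤-trans le
                                                    (*-monoʳ-≤ (fromℕ-nonNeg (length (x′ ∷ xs))) y≤x)) ⟩
      f x + fromℕ (length (x′ ∷ xs)) * f x       ≈⟨ suc-* (length (x′ ∷ xs)) (f x) ⟩
      fromℕ (length (x ∷ x′ ∷ xs)) * f x         ∎)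

-- An oblivious adversary against a randomized algorithm.

module Adversary {a ℓ₁ ℓ₂ : Level} (𝔽 : ArchimedeanOrderedField a ℓ₁ ℓ₂)
  (X : MSS.FiniteMetricSpace 𝔽) {m : ℕ} (𝒦 : MSS.RequestTypes 𝔽 X m)
  (𝒜 : MSS.Service.RandomizedAlgorithm 𝔽 X 𝒦)
  where

  open ArchimedeanOrderedField 𝔽
  open CommutativeRing commutativeRing
    using (+-congˡ; +-congʳ; *-congˡ; *-congʳ; *-identityˡ; distribˡ;
           zeroˡ; zeroʳ; reflexive)
  open OrderedFieldProperties 𝔽
  open MSS 𝔽
  open FiniteMetricSpace X
  open RequestTypes 𝒦
  open Service X 𝒦
  open RandomizedAlgorithm 𝒜
  open PosetReasoning (TotalOrder.poset totalOrder)

  ∑-const-prob : ∀ s₀ h i c → ∑ (λ x → prob s₀ h i x * c) ≈ c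
  ∑-const-prob s₀ h i c =
    trans (∑-*ʳ points (prob s₀ h i) c) (trans (*-congʳ (total s₀ h i)) (*-identityˡ c))

  -- c ranges over the field since the induction subtracts distances from it.
  expectedCost-atLeast : ∀ s₀ ρ h c → (∀ xs → Feasible ρ xs → c ≤ cost (current s₀ h) xs) →
                         c ≤ expectedCostFrom 𝒜 s₀ h ρ
  expectedCost-atLeast s₀ []      h c lb = lb [] []
  expectedCost-atLeast s₀ (i ∷ ρ) h c lb = begin
    c                                  ≈⟨ ∑-const-prob s₀ h i c ⟨
    ∑ (λ x → prob s₀ h i x * c)        ≤⟨ ∑-mono points bound ⟩
    expectedCostFrom 𝒜 s₀ h (i ∷ ρ)    ∎
    where
    bound : ∀ x → prob s₀ h i x * c ≤
      prob s₀ h i x * (d (current s₀ h) x + expectedCostFrom 𝒜 s₀ ((i , x) ∷ h) ρ)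
    bound x with T? (K i x)
    ... | yes x∈K = *-monoʳ-≤ (nonNeg s₀ h i x) (x-y≤z⇒x≤y+z
      (expectedCost-atLeast s₀ ρ ((i , x) ∷ h) _
        (λ xs sv → x≤y+z⇒x-y≤z (lb (x ∷ xs) (x∈K ∷ sv)))))
    ... | no  x∉K = ≤-reflexive (trans (vanishes c) (sym (vanishes _)))
      where
      vanishes : ∀ y → prob s₀ h i x * y ≈ 0#
      vanishes y = trans (*-congʳ (feasible s₀ h i x x∉K)) (zeroˡ y)

  module _ (s₀ : Point) {q : ℕ} (block : Fin (suc q) → List (Fin m)) {loss : Carrier}
    (averageLoss : ∀ h → loss ≤ ∑[ allFin (suc q) ] (λ σ → expectedCostFrom 𝒜 s₀ h (block σ)))
    where

    private
      EC : History → List (Fin m) → Carrier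
      EC = expectedCostFrom 𝒜 s₀

      kinds : List (Fin (suc q))
      kinds = allFin (suc q)

      N : Carrier
      N = fromℕ (suc q)

    -- The kind must not depend on the random states reached during `ρ`, so the sum over kinds stays
    -- outside the expectation. It is exchanged with the expectation one request at a time, until
    -- `averageLoss` applies to each history at the end of `ρ`.
    ∑-append : ∀ ρ h → ∑[ kinds ] (λ _ → EC h ρ) + loss ≤ ∑[ kinds ] (λ σ → EC h (ρ ++ block σ))
    ∑-append []      h = begin
      ∑[ kinds ] (λ _ → 0#) + loss ≈⟨ +-congʳ (trans (∑-const kinds 0#) (zeroʳ _)) ⟩
      0# + loss                    ≈⟨ +-identityˡ loss ⟩
      loss                         ≤⟨ averageLoss h ⟩
      ∑[ kinds ] (λ σ → EC h (block σ)) ∎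
    ∑-append (i ∷ ρ) h = begin
      ∑[ kinds ] (λ _ → ∑ λ x → p x * (δ x + now x)) + loss
        ≈⟨ +-cong (∑-average points kinds p (λ x _ → δ x + now x)) (sym (∑-const-prob s₀ h i loss)) ⟩
      ∑ (λ x → p x * ∑[ kinds ] (λ _ → δ x + now x)) + ∑ (λ x → p x * loss)
        ≈⟨ ∑-+ points _ _ ⟨
      ∑ (λ x → p x * ∑[ kinds ] (λ _ → δ x + now x) + p x * loss)
        ≤⟨ ∑-mono points (λ x → ≤-trans (≤-reflexive (sym (distribˡ (p x) _ loss)))
             (*-monoʳ-≤ (nonNeg s₀ h i x) (step x))) ⟩
      ∑ (λ x → p x * ∑[ kinds ] (λ σ → δ x + later x σ))
        ≈⟨ ∑-average points kinds p (λ x σ → δ x + later x σ) ⟨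
      ∑[ kinds ] (λ σ → EC h (i ∷ ρ ++ block σ)) ∎
      where
      p δ now : Point → Carrier
      p x = prob s₀ h i x
      δ x = d (current s₀ h) x
      now x = EC ((i , x) ∷ h) ρ

      later : Point → Fin (suc q) → Carrier
      later x σ = EC ((i , x) ∷ h) (ρ ++ block σ)

      step : ∀ x → ∑[ kinds ] (λ _ → δ x + now x) + loss ≤ ∑[ kinds ] (λ σ → δ x + later x σ)
      step x = begin
        ∑[ kinds ] (λ _ → δ x + now x) + loss
          ≈⟨ +-congʳ (∑-+ kinds _ _) ⟩
        ∑[ kinds ] (λ _ → δ x) + ∑[ kinds ] (λ _ → now x) + loss
          ≈⟨ +-assoc _ _ _ ⟩
        ∑[ kinds ] (λ _ → δ x) + (∑[ kinds ] (λ _ → now x) + loss)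
          ≤⟨ +-monoʳ-≤ _ (∑-append ρ ((i , x) ∷ h)) ⟩
        ∑[ kinds ] (λ _ → δ x) + ∑[ kinds ] (later x)
          ≈⟨ ∑-+ kinds _ _ ⟨
        ∑[ kinds ] (λ σ → δ x + later x σ) ∎

    length-kinds : length kinds ≡ suc q
    length-kinds = length-tabulate {n = suc q} id

    -- The most expensive kind raises the expected cost by at least the average `loss / N`;
    -- multiplying by `N` avoids the division.
    costlyBlock : ∀ ρ → ∃ λ σ → N * EC [] ρ + loss ≤ N * EC [] (ρ ++ block σ)
    costlyBlock ρ =
      -- `allFin (suc q)` unfolds to `zero ∷ List.tabulate suc`, which exhibits it as non-empty.
      let σ , le = ∑≤length*max zero (List.tabulate suc) (λ σ → EC [] (ρ ++ block σ))
      in σ , (begin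
        N * EC [] ρ + loss                       ≡⟨ ≡.cong (λ l → fromℕ l * EC [] ρ + loss) length-kinds ⟨
        fromℕ (length kinds) * EC [] ρ + loss    ≈⟨ +-congʳ (∑-const kinds (EC [] ρ)) ⟨
        ∑[ kinds ] (λ _ → EC [] ρ) + loss        ≤⟨ ∑-append ρ [] ⟩
        ∑[ kinds ] (λ σ → EC [] (ρ ++ block σ))  ≤⟨ le ⟩
        fromℕ (length kinds) * EC [] (ρ ++ block σ)
          ≡⟨ ≡.cong (λ l → fromℕ l * EC [] (ρ ++ block σ)) length-kinds ⟩
        N * EC [] (ρ ++ block σ)                 ∎)

    costlyBlocks : ∀ l ρ → ∃ λ (σs : Vec (Fin (suc q)) l) →
      N * EC [] ρ + fromℕ l * loss ≤ N * EC [] (ρ ++ concatMap block (toList σs))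
    costlyBlocks zero    ρ = [] , ≤-reflexive (trans (+-congˡ (zeroˡ loss))
      (trans (+-identityʳ _)
        (*-congˡ (reflexive (≡.cong (EC []) (≡.sym (++-identityʳ ρ)))))))
    costlyBlocks (suc l) ρ =
      let σ  , le  = costlyBlock ρ
          σs , le′ = costlyBlocks l (ρ ++ block σ)
      in σ ∷ σs , (begin
        N * EC [] ρ + fromℕ (suc l) * loss
          ≈⟨ +-congˡ (suc-* l loss) ⟨
        N * EC [] ρ + (loss + fromℕ l * loss)
          ≈⟨ +-assoc _ _ _ ⟨
        N * EC [] ρ + loss + fromℕ l * loss
          ≤⟨ +-monoˡ-≤ _ le ⟩
        N * EC [] (ρ ++ block σ) + fromℕ l * loss
          ≤⟨ le′ ⟩
        N * EC [] ((ρ ++ block σ) ++ concatMap block (toList σs))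
          ≡⟨ ≡.cong (λ ρ′ → N * EC [] ρ′) (++-assoc ρ (block σ) _) ⟩
        N * EC [] (ρ ++ block σ ++ concatMap block (toList σs)) ∎)

-- The lower bound on the competitive ratio.

module LowerBound {a ℓ₁ ℓ₂ : Level} (𝔽 : ArchimedeanOrderedField a ℓ₁ ℓ₂) where

  open ArchimedeanOrderedField 𝔽
  open CommutativeRing commutativeRing
    using (+-congˡ; +-congʳ; *-cong; *-congˡ; *-congʳ; *-identityˡ; zeroˡ; zeroʳ; commutativeSemiring)
  open NatSolver commutativeSemiring using (solve; _:+_; _:*_; _:=_)
  open OrderedFieldProperties 𝔽
  open MSS 𝔽
  open Discrete
  open Trees 𝔽
  open PosetReasoning (TotalOrder.poset totalOrder)

  depth-fromℕ : ∀ {k} (ws : Vec ℕ k) → depth (Vec.map fromℕ ws) ≈ fromℕ (depthℕ ws)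
  depth-fromℕ []       = refl
  depth-fromℕ (w ∷ ws) = trans (+-congˡ (depth-fromℕ ws)) (sym (fromℕ-+ w (depthℕ ws)))

  dist-fromℕ : ∀ {k} (ws : Vec ℕ k) t x y → dist (Vec.map fromℕ ws) t x y ≈ fromℕ (distℕ ws t x y)
  dist-fromℕ []       leaf        _       _       = refl
  dist-fromℕ (w ∷ ws) (node n ts) (i , x) (j , y) with i ≟ j
  ... | yes ≡.refl = dist-fromℕ ws (ts i) x y
  ... | no  _      = begin-equality
    depth (Vec.map fromℕ (w ∷ ws)) + depth (Vec.map fromℕ (w ∷ ws))
      ≈⟨ +-cong (depth-fromℕ (w ∷ ws)) (depth-fromℕ (w ∷ ws)) ⟩
    fromℕ D + fromℕ D       ≈⟨ fromℕ-+ D D ⟨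
    fromℕ (D ℕ.+ D)         ≡⟨ ≡.cong (λ x → fromℕ (D ℕ.+ x)) (ℕₚ.+-identityʳ D) ⟨
    fromℕ (2 ℕ.* D)         ∎
    where D = depthℕ (w ∷ ws)

  module _ (n : ℕ → ℕ) (𝓑 : ∀ j → Antichain (suc (n (suc j))) (suc (n j))) (j : ℕ)
    (2≤N : 2 ℕ.≤ suc (n j)) where

    open Gadgets n 𝓑

    private
      N h W : ℕ
      N = suc (n j)
      h = ⌈ N /2⌉
      W = scale j h

    open Root j h

    hst : HST (suc j)
    hst = record
      { tree     = rootTree
      ; weights  = Vec.map fromℕ rootWeights
      ; positive = VecAllₚ.map⁺ (VecAll.map 0<fromℕ rootWeights-pos)
      }

    requestTypes : RequestTypes (leafSpace hst) (suc (n 0))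
    requestTypes = record { K = rootLabel ; nonEmpty = rootLabel-nonEmpty (0<⌈n/2⌉ 2≤N) }

    open Service (leafSpace hst) requestTypes

    cost-fromℕ : ∀ s xs → cost s xs ≈ fromℕ (Route.routeLength s xs)
    cost-fromℕ s []       = refl
    cost-fromℕ s (x ∷ xs) = trans
      (+-cong (dist-fromℕ rootWeights rootTree s x) (cost-fromℕ x xs))
      (sym (fromℕ-+ (distℕ rootWeights rootTree s x) (Route.routeLength x xs)))

    cost*≤ : ∀ {C ρ} → Route.Within C ρ → ∀ s → cost* s ρ ≤ fromℕ C
    cost*≤ {C} {ρ} ub s = let xs , sv , le = ub s in begin
      cost* s ρ                    ≤⟨ proj₂ (proj₂ (optimum s ρ)) xs sv ⟩
      cost s xs                    ≈⟨ cost-fromℕ s xs ⟩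
      fromℕ (Route.routeLength s xs) ≤⟨ fromℕ-mono le ⟩
      fromℕ C                      ∎

    module _ (𝒜 : RandomizedAlgorithm) where

      open Adversary 𝔽 (leafSpace hst) requestTypes 𝒜

      s₀ : Leaf rootTree
      s₀ = firstLeaf rootTree

      blockLoss : ℕ
      blockLoss = (N ∸ h) ℕ.* (2 ℕ.* W)

      -- `loss-forced` bounds every feasible continuation from the current leaf, hence also the
      -- expected cost, whatever the history was.
      averageLoss : ∀ H → fromℕ blockLoss ≤
                    ∑[ allFin N ] (λ σ → expectedCostFrom 𝒜 s₀ H (requests j h σ))
      averageLoss H = begin
        fromℕ blockLoss
          ≤⟨ fromℕ-mono (loss-total (current s₀ H)) ⟩
        fromℕ (sum (map (loss (current s₀ H)) (allFin N)))
          ≈⟨ ∑-fromℕ (allFin N) (loss (current s₀ H)) ⟨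
        ∑[ allFin N ] (fromℕ ∘ loss (current s₀ H))
          ≤⟨ ∑-mono (allFin N) (λ σ → expectedCost-atLeast s₀ (requests j h σ) H _ λ xs sv →
               ≤-trans (fromℕ-mono (loss-forced (current s₀ H) σ xs sv))
                       (≤-reflexive (sym (cost-fromℕ (current s₀ H) xs)))) ⟩
        ∑[ allFin N ] (λ σ → expectedCostFrom 𝒜 s₀ H (requests j h σ)) ∎

      -- Each phase appends `h` blocks, every one chosen against the expected cost of the prefix
      -- before it. The offline bounds add up because `Within` holds from every start, so a phase
      -- may begin where the previous one ended.
      manyPhases : ∀ P → ∃ λ ρ → Route.Within (P ℕ.* (3 ℕ.* W)) ρ ×
        fromℕ P * fromℕ (h ℕ.* blockLoss) ≤ fromℕ N * expectedCost 𝒜 s₀ ρ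
      manyPhases zero    = [] , Route.within-[] ,
        ≤-reflexive (trans (zeroˡ _) (sym (zeroʳ (fromℕ N))))
      manyPhases (suc P) =
        let ρ  , ub , le = manyPhases P
            σs , le′     = costlyBlocks s₀ (requests j h) averageLoss h ρ
            phase        = concatMap (requests j h) (toList σs)
        in ρ ++ phase ,
           ≡.subst (λ C → Route.Within C (ρ ++ phase)) (ℕₚ.+-comm (P ℕ.* (3 ℕ.* W)) (3 ℕ.* W))
             (Route.within-++ ub (phase-within σs)) , (begin
        fromℕ (suc P) * fromℕ (h ℕ.* blockLoss)
          ≈⟨ suc-* P _ ⟨
        fromℕ (h ℕ.* blockLoss) + fromℕ P * fromℕ (h ℕ.* blockLoss)
          ≈⟨ +-comm _ _ ⟩
        fromℕ P * fromℕ (h ℕ.* blockLoss) + fromℕ (h ℕ.* blockLoss)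
          ≤⟨ +-mono-≤ le (≤-reflexive (fromℕ-* h blockLoss)) ⟩
        fromℕ N * expectedCost 𝒜 s₀ ρ + fromℕ h * fromℕ blockLoss
          ≤⟨ le′ ⟩
        fromℕ N * expectedCost 𝒜 s₀ (ρ ++ phase) ∎)

      -- Comparing `P` phases and dropping `β` leaves `h * blockLoss ≤ N * (c * (3 * W))`. By
      -- `halves-product`, three times the left side is at least `N * W * N`, and `N * W` cancels.
      competitive-nonNeg : ∀ {c} → 0# ≤ c → Competitive 𝒜 c → fromℕ N ≤ fromℕ 9 * c
      competitive-nonNeg {c} 0≤c (β , comp) = *-cancelˡ-≤ (0<fromℕ 0<NW) (begin
        fromℕ (N ℕ.* W) * fromℕ N               ≈⟨ fromℕ-* (N ℕ.* W) N ⟨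
        fromℕ (N ℕ.* W ℕ.* N)                   ≤⟨ fromℕ-mono numeric ⟩
        fromℕ (3 ℕ.* (h ℕ.* blockLoss))         ≈⟨ fromℕ-* 3 (h ℕ.* blockLoss) ⟩
        fromℕ 3 * fromℕ (h ℕ.* blockLoss)       ≤⟨ *-monoʳ-≤ (fromℕ-nonNeg 3) (drop-constant phases) ⟩
        fromℕ 3 * (fromℕ N * (c * fromℕ (3 ℕ.* W)))
          ≈⟨ *-congˡ (*-congˡ (*-congˡ (fromℕ-* 3 W))) ⟩
        fromℕ 3 * (fromℕ N * (c * (fromℕ 3 * fromℕ W)))
          ≈⟨ solve 4 (λ t N c w → t :* (N :* (c :* (t :* w))) := (N :* w) :* ((t :* t) :* c))
               refl (fromℕ 3) (fromℕ N) c (fromℕ W) ⟩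
        (fromℕ N * fromℕ W) * ((fromℕ 3 * fromℕ 3) * c)
          ≈⟨ *-cong (fromℕ-* N W) (*-congʳ (fromℕ-* 3 3)) ⟨
        fromℕ (N ℕ.* W) * (fromℕ 9 * c) ∎)
        where
        0<NW : 0 ℕ.< N ℕ.* W
        0<NW = ℕₚ.*-mono-≤ {1} {N} {1} (s≤s z≤n) (scale-pos j h)

        numeric : N ℕ.* W ℕ.* N ℕ.≤ 3 ℕ.* (h ℕ.* blockLoss)
        numeric = ℕₚ.≤-trans (ℕₚ.≤-reflexive (swap N W))
          (ℕₚ.≤-trans (ℕₚ.*-monoˡ-≤ W (halves-product N 2≤N))
            (ℕₚ.≤-reflexive (reassociate h (N ∸ h) W)))
          where
          swap : ∀ N W → N ℕ.* W ℕ.* N ≡ N ℕ.* N ℕ.* W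
          swap = solve-∀
          reassociate : ∀ h r W → 3 ℕ.* (h ℕ.* (r ℕ.* 2)) ℕ.* W ≡ 3 ℕ.* (h ℕ.* (r ℕ.* (2 ℕ.* W)))
          reassociate = solve-∀

        phases : ∀ P → fromℕ P * fromℕ (h ℕ.* blockLoss) ≤
                 fromℕ P * (fromℕ N * (c * fromℕ (3 ℕ.* W))) + fromℕ N * β
        phases P = let ρ , ub , le = manyPhases P in begin
          fromℕ P * fromℕ (h ℕ.* blockLoss)
            ≤⟨ le ⟩
          fromℕ N * expectedCost 𝒜 s₀ ρ
            ≤⟨ *-monoʳ-≤ (fromℕ-nonNeg N) (comp s₀ ρ) ⟩
          fromℕ N * (c * cost* s₀ ρ + β)
            -- Replacing the optimum by an upper bound for it relies on `0# ≤ c`; negative ratios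
            -- are therefore treated separately.
            ≤⟨ *-monoʳ-≤ (fromℕ-nonNeg N) (+-monoˡ-≤ β (*-monoʳ-≤ 0≤c (cost*≤ ub s₀))) ⟩
          fromℕ N * (c * fromℕ (P ℕ.* (3 ℕ.* W)) + β)
            ≈⟨ *-congˡ (+-congʳ (*-congˡ (fromℕ-* P (3 ℕ.* W)))) ⟩
          fromℕ N * (c * (fromℕ P * fromℕ (3 ℕ.* W)) + β)
            ≈⟨ solve 5 (λ N c p w b → N :* (c :* (p :* w) :+ b) := p :* (N :* (c :* w)) :+ N :* b)
                 refl (fromℕ N) c (fromℕ P) (fromℕ (3 ℕ.* W)) β ⟩
          fromℕ P * (fromℕ N * (c * fromℕ (3 ℕ.* W))) + fromℕ N * β ∎

      cost*-nonNeg : ∀ s ρ → 0# ≤ cost* s ρ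
      cost*-nonNeg s ρ = ≤-trans (fromℕ-nonNeg (Route.routeLength s xs))
        (≤-reflexive (sym (cost-fromℕ s xs)))
        where xs = proj₁ (optimum s ρ)

      competitive : ∀ {c} → Competitive 𝒜 c → fromℕ N ≤ fromℕ 9 * c
      competitive {c} (β , comp) with ≤-total 0# c
      ... | inj₁ 0≤c = competitive-nonNeg 0≤c (β , comp)
      -- An algorithm with a negative ratio would also have ratio 0.
      ... | inj₂ c≤0 = ⊥-elim (proj₂ (0<fromℕ {N} (s≤s z≤n)) (≤-antisym (fromℕ-nonNeg N) (begin
        fromℕ N       ≤⟨ competitive-nonNeg ≤-refl (β , λ s ρ → ≤-trans (comp s ρ)
                           (+-monoˡ-≤ β (*-monoˡ-≤ (cost*-nonNeg s ρ) c≤0))) ⟩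
        fromℕ 9 * 0#  ≈⟨ zeroʳ (fromℕ 9) ⟩
        0#            ∎)))

    achievable : ∀ {c} → Achievable (suc j) (suc (n 0)) c → fromℕ N ≤ fromℕ 9 * c
    achievable ach = let 𝒜 , comp = ach hst requestTypes in competitive 𝒜 comp

  -- 9 = 3 * 3: the optimum pays at most 3 W per phase, the algorithm at least
  -- 2 h (N ∸ h) W / N, and N² ≤ 3 * 2 h (N ∸ h).
  ninth : ∃ λ κ → fromℕ 9 * κ ≈ 1#
  ninth = invertible (fromℕ 9) (proj₂ (0<fromℕ {9} (s≤s z≤n)) ∘ sym)

  κ : Carrier
  κ = proj₁ ninth

  0<κ : 0# < κ
  0<κ = *-cancelˡ-≤ (0<fromℕ {9} (s≤s z≤n)) (begin
      fromℕ 9 * 0# ≈⟨ zeroʳ (fromℕ 9) ⟩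
      0#           ≤⟨ 0≤1 ⟩
      1#           ≈⟨ proj₂ ninth ⟨
      fromℕ 9 * κ  ∎) ,
    λ 0≈κ → 0≉1 (trans (sym (zeroʳ (fromℕ 9))) (trans (*-congˡ 0≈κ) (proj₂ ninth)))

  achievable⇒κA≤ : ∀ j m → 2 ℕ.≤ m → ∀ c → Achievable (suc j) m c → κ * fromℕ (A j m) ≤ c
  achievable⇒κA≤ j (suc m) 2≤m c ach = begin
    κ * fromℕ (A j (suc m))   ≡⟨ ≡.cong (λ N → κ * fromℕ N) (A≡ j) ⟨
    κ * fromℕ (suc (n j))     ≤⟨ *-monoʳ-≤ (proj₁ 0<κ) (achievable n 𝓑 j
                                   (≡.subst (2 ℕ.≤_) (≡.sym (A≡ j)) (2≤A j 2≤m)) ach) ⟩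
    κ * (fromℕ 9 * c)         ≈⟨ solve 3 (λ k n c → k :* (n :* c) := n :* k :* c) refl κ (fromℕ 9) c ⟩
    fromℕ 9 * κ * c           ≈⟨ *-congʳ (proj₂ ninth) ⟩
    1# * c                    ≈⟨ *-identityˡ c ⟩
    c                         ∎
    where
    n : ℕ → ℕ
    -- No truncation occurs, since `A j (suc m)` is at least 2; `A≡` recovers it as `suc (n j)`.
    n j = pred (A j (suc m))

    A≡ : ∀ j → suc (n j) ≡ A j (suc m)
    A≡ j with A j (suc m) | 2≤A j 2≤m
    ... | suc _ | _ = ≡.refl

    𝓑 : ∀ j → Antichain (suc (n (suc j))) (suc (n j))
    𝓑 j = ≡.subst₂ Antichain (≡.sym (A≡ (suc j))) (≡.sym (A≡ j))
      (halfSubsets (A j (suc m)) (2≤A j 2≤m))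

theorem4p8 : {a ℓ₁ ℓ₂ : Level} (F : ArchimedeanOrderedField a ℓ₁ ℓ₂) →
    let open ArchimedeanOrderedField F
        open MSS F
    in ∃ λ κ → 0# < κ ×
         ((k m : ℕ) → 3 ℕ.≤ k → 2 ℕ.≤ m →
           κ * fromℕ (A (k ∸ 1) m) ≤inf Achievable k m)
theorem4p8 F = κ , 0<κ , λ { (suc j) m _ 2≤m → achievable⇒κA≤ j m 2≤m }
  where open LowerBound F
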